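{- Let $q$ be even, $t\ge 3$ a prime, $q\ge t$. In $\mathrm{PG}(2,q^t)$, let $\mathcal C$ be a conic and let $\mathcal D$ be an André set of $\ell_\infty$. For $m\in\{1,\ldots,t-1\}$ perform an André replacement using the André replacement net $\mathcal D^m$, and let $\mathcal D_m(\mathcal C)$ denote the set of points in the André plane $\mathcal P(\mathcal D^m)$ corresponding to the affine points of $\mathcal C$. If $\mathcal C$ has nucleus $N$ and is tangent to the line $\ell_\infty$ at the point $T$, with $T,N\in\mathcal D$, then $\mathcal D_m(\mathcal C)$ is not an arc in $\mathcal P(\mathcal D^m)$ for any $m\in\{1,\ldots,t-1\}$.
   Context: Conics are non-degenerate. As $q$ is even, all tangent lines of a conic pass through a common point, its nucleus. Homogeneous coordinates of $\mathrm{PG}(2,q^t)$ are $(x,y,z)$, with $\ell_\infty$ the line $z=0$; the point $(x,y,0)$ of $\ell_\infty\cong\mathrm{PG}(1,q^t)$ is also written $(x,y)$. Affine points are the points not on $\ell_\infty$; $(x,y,1)$ is identified with the vector $(x,y)\in V=\mathbb F_{q^t}^2$. An arc of a projective plane is a set of points, no three collinear. Norm: $\mathrm N(k)=k^{1+q+\cdots+q^{t-1}}$ for $k\in\mathbb F_{q^t}$. André sets: for distinct points $E,F$ of $\mathrm{PG}(1,q^t)$, let $G\le \mathrm{PGL}(2,q^t)$ be the group (cyclic of order $q^t-1$) of projectivities fixing both $E$ and $F$, and $H$ its unique subgroup of order $q^{t-1}+\cdots+q+1$. The $q-1$ orbits of $H$ on $\mathrm{PG}(1,q^t)\setminus\{E,F\}$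 are the André sets with transversal points $E,F$. The André sets with transversal points $(1,0),(0,1)$ are $\mathcal A_\delta=\{(1,\theta)\mid \theta\in\mathbb F_{q^t}^*,\ \mathrm N(\theta)=\delta\}$, $\delta\in\mathbb F_q^*$, and every André set is the image of such a set under a projectivity. Bruck–Bose representation: regard $V$ as a $2t$-dimensional $\mathbb F_q$-space, so affine points of $\mathrm{PG}(2,q^t)$ are the points of $\mathrm{AG}(2t,q)$. A point $P=(x,y)$ of $\ell_\infty$ corresponds to the $t$-dimensional $\mathbb F_q$-subspace $[P]=\{(sx,sy)\mid s\in\mathbb F_{q^t}\}$ of $V$ (projectively a $(t-1)$-space of the hyperplane at infinity $\mathrm{PG}(2t-1,q)$); the affine lines through $P$ are the cosets of $[P]$. André replacement nets: for $\mathcal D=\mathcal A_\delta$ and $m\in\{1,\ldots,t-1\}$, $\mathcal D^m=\{X_{m,u}\mid u\in\mathbb F_{q^t}^*,\mathrm N(u)=\delta\}$ where $X_{m,u}=\{(s,s^{q^m}u)\mid s\in\mathbb F_{q^t}\}$, a $t$-dimensional $\mathbb F_q$-subspace of $V$. For a general André set $\mathcal D$, choose $\varphi\in\mathrm{GL}(2,q^t)$ inducing a projectivity mapping some $\mathcal A_\delta$ to $\mathcal D$; the $t-1$ replacement nets of $\mathcal D$ are $\mathcal D^m=\{\varphi(X_{m,u})\}$, the images of those of $\mathcal A_\delta$. André replacement: a $\mathcal D^m$-block is a coset in $V$ of a member of $\mathcal D^m$. The incidence structure whose points are the affine points of $\mathrm{PG}(2,q^t)$ and whose lines are the affine lines of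 $\mathrm{PG}(2,q^t)$ meeting $\ell_\infty$ in a point not in $\mathcal D$, together with the $\mathcal D^m$-blocks, is an affine plane of order $q^t$; its projective completion is the André plane $\mathcal P(\mathcal D^m)$. -}

module Defs where

open import Algebra.Apartness.Bundles using (HeytingCommutativeRing; HeytingField)
open import Algebra.Bundles using (CommutativeRing)
open import Algebra.Module.Bundles using (Module)
import Algebra.Module.Construct.DirectProduct as DirectProduct
import Algebra.Module.Construct.TensorUnit as TensorUnit
import Algebra.Properties.Semiring.Exp as Exp
open import Data.Empty.Polymorphic using (⊥)
open import Data.Fin.Base using (Fin)
open import Data.List.Base using (applyUpTo)
open import Data.Maybe.Base using (Maybe; just; nothing)
open import Data.Nat.Base as ℕ using (ℕ; suc)
open import Data.Nat.ListAction using (sum)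
open import Data.Nat.Primality using (Prime)
open import Data.Product.Base using (Σ; Σ-syntax; ∃₂; ∃-syntax; _×_; _,_; proj₁; proj₂)
open import Data.Sum.Base using (_⊎_; inj₁; inj₂)
open import Data.Sum.Relation.Binary.Pointwise using (Pointwise)
open import Function.Base using (_on_)
open import Function.Bundles using (_⇔_)
open import Function.Definitions using (Bijective)
open import Level using (Level; _⊔_) renaming (suc to lsuc)
open import Relation.Binary.Core using (Rel; REL)
open import Relation.Binary.PropositionalEquality.Core using (_≡_)
open import Relation.Nullary.Negation using (¬_)
open import Relation.Unary using (Pred; _∈_; _∉_; _≐_)

IsPrimePower : ℕ → Set
IsPrimePower q = ∃₂ λ p k → Prime p × q ≡ p ℕ.^ suc k

-- 1 + q + ⋯ + q ^ (t - 1)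
geometricSum : ℕ → ℕ → ℕ
geometricSum q t = sum (applyUpTo (q ℕ.^_) t)

HasOrder : ∀ {a ℓ} {A : Set a} → Rel A ℓ → ℕ → Set (a ⊔ ℓ)
HasOrder {A = A} _≈_ n = Σ[ f ∈ (Fin n → A) ] Bijective _≡_ _≈_ f

record IncidenceStructure (p e l i : Level) : Set (lsuc (p ⊔ e ⊔ l ⊔ i)) where
  infix 4 _≈_ _I_ _∥_
  field
    Point : Set p
    _≈_   : Rel Point e
    Line  : Set l
    _I_   : REL Point Line i

  _∥_ : Rel Line (p ⊔ i)
  ℓ ∥ ℓ′ = (∀ P → P I ℓ ⇔ P I ℓ′) ⊎ (∀ P → ¬ (P I ℓ × P I ℓ′))

  IsArc : ∀ {s} → Pred Point s → Set (p ⊔ e ⊔ l ⊔ i ⊔ s)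
  IsArc S = ∀ {P Q R} → P ∈ S → Q ∈ S → R ∈ S →
            ¬ P ≈ Q → ¬ P ≈ R → ¬ Q ≈ R →
            ¬ (∃[ ℓ ] (P I ℓ × Q I ℓ × R I ℓ))

-- The points at infinity of an affine plane are its parallel classes, each
-- represented by any of its lines; `nothing` is the line at infinity.
module _ {p e l i} (𝒜 : IncidenceStructure p e l i) where
  open IncidenceStructure 𝒜

  data CompletionIncidence : REL (Point ⊎ Line) (Maybe Line) (p ⊔ l ⊔ i) where
    affine : ∀ {P ℓ} → P I ℓ → CompletionIncidence (inj₁ P) (just ℓ)
    ideal  : ∀ {ℓ ℓ′} → ℓ ∥ ℓ′ → CompletionIncidence (inj₂ ℓ) (just ℓ′)
    atInfinity : ∀ {ℓ} → CompletionIncidence (inj₂ ℓ) nothing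

  projectiveCompletion : IncidenceStructure (p ⊔ l) (p ⊔ e ⊔ l ⊔ i) l (p ⊔ l ⊔ i)
  projectiveCompletion = record
    { Point = Point ⊎ Line
    ; _≈_   = Pointwise _≈_ _∥_
    ; Line  = Maybe Line
    ; _I_   = CompletionIncidence
    }

module Geometry {κ ℓ₁ ℓ₂} (K : HeytingField κ ℓ₁ ℓ₂) (q t : ℕ) where

  private
    module K = HeytingField K

  commutativeRing : CommutativeRing κ ℓ₁
  commutativeRing = HeytingCommutativeRing.commutativeRing K.heytingCommutativeRing

  open CommutativeRing commutativeRing public
    using (Carrier; _≈_; _≉_; _+_; _*_; -_; _-_; 0#; 1#; semiring)
  open Exp semiring public using (_^_)

  private
    module R = CommutativeRing commutativeRing

  1≉0 : 1# ≉ 0#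
  1≉0 1≈0 = K.#-irrefl R.refl (K.invertible⇒# {0#} {0#} (0# , 0*≈1 , *0≈1))
    where
    0≈1 = R.sym 1≈0
    0*≈1 = R.trans (R.zeroˡ _) 0≈1
    *0≈1 = R.trans (R.zeroʳ _) 0≈1

  K¹ : Module commutativeRing κ ℓ₁
  K¹ = TensorUnit.⟨module⟩

  K² : Module commutativeRing κ ℓ₁
  K² = DirectProduct.⟨module⟩ K¹ K¹

  K³ : Module commutativeRing κ ℓ₁
  K³ = DirectProduct.⟨module⟩ K² K¹

  -- Matrices, by rows.
  K²ˣ² : Module commutativeRing κ ℓ₁
  K²ˣ² = DirectProduct.⟨module⟩ K² K²

  module Projective (M : Module commutativeRing κ ℓ₁) where
    open Module M

    infix 4 _∼_
    _∼_ : Rel Carrierᴹ (κ ⊔ ℓ₁)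
    v ∼ w = ∃[ k ] (k ≉ 0# × v ≈ᴹ k *ₗ w)

    Point : Set (κ ⊔ ℓ₁)
    Point = Σ[ v ∈ Carrierᴹ ] ¬ v ≈ᴹ 0ᴹ

  open Projective K² public using () renaming (_∼_ to _∼₁_; Point to Point₁)
  open Projective K³ public using () renaming (_∼_ to _∼₂_; Point to Point₂)
  open Projective K²ˣ² public using () renaming (_∼_ to _∼ₘ_)

  open Module K² public using ()
    renaming (Carrierᴹ to V; _≈ᴹ_ to _≈ᵥ_; _+ᴹ_ to _+ᵥ_)
  open Module K³ public using ()
    renaming (Carrierᴹ to V₃; _≈ᴹ_ to _≈₃_; _+ᴹ_ to _+₃_; 0ᴹ to 0₃)
  open Module K²ˣ² public using () renaming (Carrierᴹ to Matrix)

  -- A line of PG(2,K) is given by the coefficients of its equation.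
  Line₂ : Set (κ ⊔ ℓ₁)
  Line₂ = Point₂

  infix 4 _on₂_
  _on₂_ : REL Point₂ Line₂ ℓ₁
  (((x , y) , z) , _) on₂ (((a , b) , c) , _) = a * x + b * y + c * z ≈ 0#

  ℓ∞ : Line₂
  ℓ∞ = ((0# , 0#) , 1#) , λ where (_ , 1≈0) → 1≉0 1≈0

  affinePoint : V → Point₂
  affinePoint v = (v , 1#) , λ where (_ , 1≈0) → 1≉0 1≈0

  infinitePoint : Point₁ → Point₂
  infinitePoint (v , v≉0) = (v , 0#) , λ where (v≈0 , _) → v≉0 v≈0

  IsAffineLine : Pred Line₂ (κ ⊔ ℓ₁)
  IsAffineLine ℓ = ¬ proj₁ ℓ ∼₂ proj₁ ℓ∞

  -- The form a x² + b y² + c z² + f y z + g x z + h x y.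
  record QuadraticForm : Set κ where
    field
      a b c f g h : Carrier

    value : V₃ → Carrier
    value ((x , y) , z) =
      a * (x * x) + b * (y * y) + c * (z * z) + f * (y * z) + g * (x * z) + h * (x * y)

    polar : V₃ → V₃ → Carrier
    polar v w = value (v +₃ w) - value v - value w

    IsSingular : Pred V₃ (κ ⊔ ℓ₁)
    IsSingular v = value v ≈ 0# × (∀ w → polar v w ≈ 0#)

  record Conic : Set (κ ⊔ ℓ₁) where
    field
      form          : QuadraticForm
      nondegenerate : ∀ {v} → QuadraticForm.IsSingular form v → v ≈₃ 0₃

    points : Pred Point₂ ℓ₁
    points (v , _) = QuadraticForm.value form v ≈ 0#

    IsTangentAt : REL Line₂ Point₂ (κ ⊔ ℓ₁)
    IsTangentAt ℓ T = T ∈ points × T on₂ ℓ ×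
                      (∀ P → P ∈ points → P on₂ ℓ → proj₁ P ∼₂ proj₁ T)

    -- When K is finite of characteristic 2, exactly one point satisfies this.
    IsNucleus : Pred Point₂ (κ ⊔ ℓ₁)
    IsNucleus N = ∀ {ℓ T} → IsTangentAt ℓ T → N on₂ ℓ

  det : Matrix → Carrier
  det ((a , b) , (c , d)) = a * d - b * c

  identity : Matrix
  identity = (1# , 0#) , (0# , 1#)

  infixl 7 _·_
  _·_ : Matrix → Matrix → Matrix
  ((a , b) , (c , d)) · ((a′ , b′) , (c′ , d′)) =
    (a * a′ + b * c′ , a * b′ + b * d′) , (c * a′ + d * c′ , c * b′ + d * d′)

  infixr 7 _▹_
  _▹_ : Matrix → V → V
  ((a , b) , (c , d)) ▹ (x , y) = a * x + b * y , c * x + d * y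

  -- A subgroup of PGL(2,K), as a set of matrices closed under proportionality.
  record IsSubgroup {h} (H : Pred Matrix h) : Set (κ ⊔ ℓ₁ ⊔ h) where
    field
      respects   : ∀ {g g′} → g ∼ₘ g′ → g ∈ H → g′ ∈ H
      invertible : ∀ {g} → g ∈ H → det g ≉ 0#
      1∈         : identity ∈ H
      ·-closed   : ∀ {g g′} → g ∈ H → g′ ∈ H → g · g′ ∈ H
      ⁻¹-closed  : ∀ {g} → g ∈ H → ∃[ g′ ] (g′ ∈ H × g · g′ ∼ₘ identity)

  -- For distinct E and F, the projectivities fixing both form a cyclic group of
  -- order q ^ t - 1, so these conditions determine H.
  record IsAndréGroup {h} (E F : Point₁) (H : Pred Matrix h) : Set (κ ⊔ ℓ₁ ⊔ h) where
    field
      isSubgroup : IsSubgroup H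
      fixesE     : ∀ {g} → g ∈ H → g ▹ proj₁ E ∼₁ proj₁ E
      fixesF     : ∀ {g} → g ∈ H → g ▹ proj₁ F ∼₁ proj₁ F
      order      : HasOrder {A = Σ Matrix H} (_∼ₘ_ on proj₁) (geometricSum q t)

  orbit : ∀ {h} → Pred Matrix h → Point₁ → Pred Point₁ (κ ⊔ ℓ₁ ⊔ h)
  orbit H P Q = ∃[ g ] (g ∈ H × proj₁ Q ∼₁ g ▹ proj₁ P)

  record IsAndréSet {d} (D : Pred Point₁ d) : Set (lsuc (κ ⊔ ℓ₁) ⊔ d) where
    field
      E F      : Point₁
      distinct : ¬ proj₁ E ∼₁ proj₁ F
      H        : Pred Matrix (κ ⊔ ℓ₁)
      isGroup  : IsAndréGroup E F H
      P        : Point₁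
      P≁E      : ¬ proj₁ P ∼₁ proj₁ E
      P≁F      : ¬ proj₁ P ∼₁ proj₁ F
      isOrbit  : D ≐ orbit H P

  norm : Carrier → Carrier
  norm k = k ^ geometricSum q t

  -- Membership in the multiplicative group of the subfield of order q.
  𝔽q* : Pred Carrier ℓ₁
  𝔽q* δ = δ ^ q ≈ δ × δ ≉ 0#

  𝒜 : Carrier → Pred Point₁ (κ ⊔ ℓ₁)
  𝒜 δ P = ∃[ θ ] (θ ≉ 0# × norm θ ≈ δ × proj₁ P ∼₁ (1# , θ))

  image : ∀ {s} → Matrix → Pred Point₁ s → Pred Point₁ (κ ⊔ ℓ₁ ⊔ s)
  image φ S P = ∃[ Q ] (Q ∈ S × proj₁ P ∼₁ φ ▹ proj₁ Q)

  X : ℕ → Carrier → Pred V (κ ⊔ ℓ₁)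
  X m u v = ∃[ s ] v ≈ᵥ (s , s ^ (q ℕ.^ m) * u)

  record ReplacementChart {d} (D : Pred Point₁ d) : Set (κ ⊔ ℓ₁ ⊔ d) where
    field
      φ          : Matrix
      invertible : det φ ≉ 0#
      δ          : Carrier
      δ∈𝔽q*      : δ ∈ 𝔽q*
      maps       : image φ (𝒜 δ) ≐ D

    NetIndex : Set (κ ⊔ ℓ₁)
    NetIndex = Σ[ u ∈ Carrier ] (u ≉ 0# × norm u ≈ δ)

    netMember : ℕ → NetIndex → Pred V (κ ⊔ ℓ₁)
    netMember m (u , _) v = ∃[ w ] (w ∈ X m u × v ≈ᵥ φ ▹ w)

    -- The block (i , w) is the coset w + netMember m i.
    Block : Set (κ ⊔ ℓ₁)
    Block = NetIndex × V

    _∈Block[_]_ : V → ℕ → Block → Set (κ ⊔ ℓ₁)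
    v ∈Block[ m ] (i , w) = ∃[ x ] (x ∈ netMember m i × v ≈ᵥ w +ᵥ x)

  module _ {d} {D : Pred Point₁ d} (χ : ReplacementChart D) (m : ℕ) where
    open ReplacementChart χ

    RetainedLine : Set (κ ⊔ ℓ₁ ⊔ d)
    RetainedLine = Σ[ ℓ ∈ Line₂ ]
      (IsAffineLine ℓ × (∃[ P ] (infinitePoint P on₂ ℓ × P ∉ D)))

    data AndréIncidence (v : V) : RetainedLine ⊎ Block → Set (κ ⊔ ℓ₁ ⊔ d) where
      onLine  : ∀ {ℓ} → affinePoint v on₂ proj₁ ℓ → AndréIncidence v (inj₁ ℓ)
      onBlock : ∀ {b} → v ∈Block[ m ] b → AndréIncidence v (inj₂ b)

    affineAndréPlane : IncidenceStructure κ ℓ₁ (κ ⊔ ℓ₁ ⊔ d) (κ ⊔ ℓ₁ ⊔ d)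
    affineAndréPlane = record
      { Point = V
      ; _≈_   = _≈ᵥ_
      ; Line  = RetainedLine ⊎ Block
      ; _I_   = AndréIncidence
      }

    andréPlane : IncidenceStructure (κ ⊔ ℓ₁ ⊔ d) (κ ⊔ ℓ₁ ⊔ d) (κ ⊔ ℓ₁ ⊔ d) (κ ⊔ ℓ₁ ⊔ d)
    andréPlane = projectiveCompletion affineAndréPlane

    transformedConic : Conic → Pred (IncidenceStructure.Point andréPlane) ℓ₁
    transformedConic C (inj₁ v) = affinePoint v ∈ Conic.points C
    transformedConic C (inj₂ _) = ⊥

{-# OPTIONS --safe #-}

-- In characteristic 2 the tangents of a conic pass through its nucleus, so if the conic
-- touches the line at infinity at T and has nucleus N there, its affine points are
--   (A x² + C) T + x N   for x ∈ K, with A ≠ 0.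
-- In the coordinates of the replacement chart T = (1 , θ₁) and N = (1 , θ₂) with
-- N(θ₁) = N(θ₂). Let σ : x ↦ x ^ (q ^ m). By Hilbert's Theorem 90, γ^σ θ₂ = θ₁ γ for
-- some γ ≠ 0. Put η = γ / A and u = θ₂ η / η^σ, so that N(u) = N(θ₂). If β ∈ 𝔽_q and
-- s = A (η β)² + η β = η (γ β² + β), then
--   s^σ u = θ₂ η (γ^σ β² + β) = η (θ₁ γ β² + θ₂ β),
-- so the q points with x = η β lie on the block C T + X_{m,u}, and q ≥ 3.

module Submission where

open import Defs
open import Algebra.Apartness.Bundles using (HeytingField; HeytingCommutativeRing)
open import Algebra.Bundles using (CommutativeMonoid; CommutativeRing; CommutativeSemiring)
open import Algebra.Solver.Ring.AlmostCommutativeRing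
  using (fromCommutativeRing; _-Raw-AlmostCommutative⟶_)
open import Data.Bool.Base using (Bool; true; false; _∧_; _xor_)
open import Data.Bool.Properties as Bool using (xor-∧-commutativeRing)
open import Data.Fin.Base using (Fin; zero; suc; inject≤; punchIn)
open import Data.Fin.Permutation using (Permutation′; permutation)
import Data.Fin.Properties as Fin
open import Data.List.Base using (applyUpTo)
open import Data.Maybe.Base using (Maybe; just; nothing)
open import Data.Nat as ℕ using (ℕ; zero; suc; _^_; _≤_; _<_; z≤n; s≤s)
open import Data.Nat.Coprimality as Coprime using (Coprime; coprime-Bézout; prime⇒coprime)
open import Data.Nat.Divisibility using (_∣_; divides; ∣m∣n⇒∣m+n; ∣n⇒∣m*n; ∣-refl)
open import Data.Nat.GCD using (module Bézout)
import Data.Nat.ListAction as ℕ using (sum)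
open import Data.Nat.Primality using (Prime; euclidsLemma; prime[2]; prime⇒irreducible)
import Data.Nat.Properties as ℕ
import Data.Nat.Solver as ℕ
open import Data.Product.Base using (∃-syntax; _×_; _,_; proj₁; proj₂)
open import Data.Sum.Base using (_⊎_; inj₁; inj₂)
open import Data.Sum.Relation.Binary.Pointwise using (drop-inj₁)
open import Level using (Level; _⊔_)
open import Relation.Binary.PropositionalEquality as ≡ using (_≡_; _≢_)
open import Relation.Nullary.Decidable using (Dec; yes; no; ¬?; decidable-stable)
open import Relation.Nullary.Negation using (¬_; contradiction)
open import Relation.Unary using (Pred; _∈_)

-- The values of η and u come from comparing coefficients. Apart from the translation by C T, a
-- conic point has chart coordinates A x² + x and θ₁ A x² + θ₂ x, and X_{m,u} asks that (A x² + x)^σ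
-- u = θ₁ A x² + θ₂ x. With x = η β and β fixed by σ this splits into one condition for β and one
-- for β². The first determines u; dividing the second by the first leaves γ^σ θ₂ = θ₁ γ for γ = A
-- η. This is solvable because θ₁ / θ₂ has norm 1, which is what membership of both T and N in the
-- same André set gives.
--
-- As t is prime, m is coprime to t, and the case of σ is reduced to that of the q-th power by
-- extracting a root of exponent 1 + q + ⋯ + q ^ (m - 1) among the elements of norm 1.
--
-- The field is known only through its order q ^ t. Characteristic 2 and x ^ (q ^ t) = x come from
-- permuting its elements; a nonzero resolvent and a third element of 𝔽_q come from polynomials of
-- degree below q ^ t, which cannot vanish everywhere.

private variable
  ℓ ℓ₀ ℓ₁ ℓ₂ ℓ₃ : Level

-- Arithmetic of the exponents 1 + q + ⋯ + q ^ (n - 1)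

sum-scale : ∀ c (f : ℕ → ℕ) n →
            ℕ.sum (applyUpTo (λ i → c ℕ.* f i) n) ≡ c ℕ.* ℕ.sum (applyUpTo f n)
sum-scale c f zero    = ≡.sym (ℕ.*-zeroʳ c)
sum-scale c f (suc n) = ≡.trans
  (≡.cong (c ℕ.* f 0 ℕ.+_) (sum-scale c (λ i → f (suc i)) n))
  (≡.sym (ℕ.*-distribˡ-+ c (f 0) _))

geometricSum-suc : ∀ q n → geometricSum q (suc n) ≡ 1 ℕ.+ q ℕ.* geometricSum q n
geometricSum-suc q n = ≡.cong suc (sum-scale q (q ^_) n)

geometricSum-+ : ∀ q m n →
                 geometricSum q (m ℕ.+ n) ≡ geometricSum q m ℕ.+ q ^ m ℕ.* geometricSum q n
geometricSum-+ q zero    n = ≡.sym (ℕ.*-identityˡ _)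
geometricSum-+ q (suc m) n = begin
  geometricSum q (suc (m ℕ.+ n))                 ≡⟨ geometricSum-suc q (m ℕ.+ n) ⟩
  1 ℕ.+ q ℕ.* geometricSum q (m ℕ.+ n)
    ≡⟨ ≡.cong (λ z → 1 ℕ.+ q ℕ.* z) (geometricSum-+ q m n) ⟩
  1 ℕ.+ q ℕ.* (geometricSum q m ℕ.+ q ^ m ℕ.* g)
    ≡⟨ solve 4 (λ q s r g → con 1 :+ q :* (s :+ r :* g)
        := con 1 :+ q :* s :+ q :* r :* g)
        ≡.refl q (geometricSum q m) (q ^ m) g ⟩
  1 ℕ.+ q ℕ.* geometricSum q m ℕ.+ q ^ suc m ℕ.* g
    ≡⟨ ≡.cong (ℕ._+ q ^ suc m ℕ.* g) (geometricSum-suc q m) ⟨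
  geometricSum q (suc m) ℕ.+ q ^ suc m ℕ.* g     ∎
  where
  open ≡.≡-Reasoning
  open ℕ.+-*-Solver
  g = geometricSum q n

-- Two ways to split off a digit of the all-ones number of length n + 1 in base q. As an identity of
-- exponents it makes norms fixed by the q-th power.
geometricSum-shift : ∀ q n → 1 ℕ.+ geometricSum q n ℕ.* q ≡ geometricSum q n ℕ.+ q ^ n
geometricSum-shift q n = begin
  1 ℕ.+ geometricSum q n ℕ.* q    ≡⟨ ≡.cong suc (ℕ.*-comm (geometricSum q n) q) ⟩
  1 ℕ.+ q ℕ.* geometricSum q n    ≡⟨ geometricSum-suc q n ⟨
  geometricSum q (1 ℕ.+ n)        ≡⟨ ≡.cong (geometricSum q) (ℕ.+-comm 1 n) ⟩
  geometricSum q (n ℕ.+ 1)        ≡⟨ geometricSum-+ q n 1 ⟩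
  geometricSum q n ℕ.+ q ^ n ℕ.* 1 ≡⟨ ≡.cong (geometricSum q n ℕ.+_) (ℕ.*-identityʳ (q ^ n)) ⟩
  geometricSum q n ℕ.+ q ^ n      ∎
  where open ≡.≡-Reasoning

geometricSum-∣ : ∀ q k m → geometricSum q m ∣ geometricSum q (k ℕ.* m)
geometricSum-∣ q zero    m = divides 0 ≡.refl
geometricSum-∣ q (suc k) m = ≡.subst (geometricSum q m ∣_)
  (≡.sym (geometricSum-+ q m (k ℕ.* m)))
  (∣m∣n⇒∣m+n ∣-refl (∣n⇒∣m*n (q ^ m) (geometricSum-∣ q k m)))

geometricSum-closed : ∀ p n → 1 ℕ.+ p ℕ.* geometricSum (suc p) n ≡ suc p ^ n
geometricSum-closed p zero    = ≡.cong suc (ℕ.*-zeroʳ p)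
geometricSum-closed p (suc n) = begin
  1 ℕ.+ p ℕ.* geometricSum (suc p) (suc n)
    ≡⟨ ≡.cong (λ z → 1 ℕ.+ p ℕ.* z) (geometricSum-suc (suc p) n) ⟩
  1 ℕ.+ p ℕ.* (1 ℕ.+ suc p ℕ.* g)
    ≡⟨ solve 2 (λ p g → con 1 :+ p :* (con 1 :+ (con 1 :+ p) :* g)
        := (con 1 :+ p) :* (con 1 :+ p :* g)) ≡.refl p g ⟩
  suc p ℕ.* (1 ℕ.+ p ℕ.* g)                ≡⟨ ≡.cong (suc p ℕ.*_) (geometricSum-closed p n) ⟩
  suc p ^ suc n                            ∎
  where
  open ≡.≡-Reasoning
  open ℕ.+-*-Solver
  g = geometricSum (suc p) n

-- A degree bound: x (N(x) - 1) must have degree below the number of field elements. For q = 2 the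
-- two sides are equal, in accordance with 𝔽₂ having no third element.
1+geometricSum<^ : ∀ {q n} → 3 ≤ q → 1 ≤ n → 1 ℕ.+ geometricSum q n < q ^ n
1+geometricSum<^ {suc p} {suc n} (s≤s 2≤p) _ = begin-strict
  1 ℕ.+ g               <⟨ ℕ.+-monoʳ-< 1 (ℕ.m<m*n g 2 (s≤s (s≤s z≤n))) ⟩
  1 ℕ.+ g ℕ.* 2         ≡⟨ ≡.cong suc (ℕ.*-comm g 2) ⟩
  1 ℕ.+ 2 ℕ.* g         ≤⟨ ℕ.+-monoʳ-≤ 1 (ℕ.*-monoˡ-≤ g 2≤p) ⟩
  1 ℕ.+ p ℕ.* g         ≡⟨ geometricSum-closed p (suc n) ⟩
  suc p ^ suc n         ∎
  where
  open ℕ.≤-Reasoning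
  g = geometricSum (suc p) (suc n)

-- Finite sums, and polynomial functions of bounded degree

module FiniteSum (M : CommutativeMonoid ℓ₀ ℓ) where
  open CommutativeMonoid M
  open import Algebra.Properties.CommutativeMonoid.Sum M public
  open import Relation.Binary.Reasoning.Setoid setoid

  sum-single : ∀ {n} (f : Fin n → Carrier) i → (∀ j → j ≢ i → f j ≈ ε) → sum f ≈ f i
  sum-single {suc n} f i others = begin
    sum f                              ≈⟨ sum-remove {i = i} f ⟩
    f i ∙ sum (λ j → f (punchIn i j))
      ≈⟨ ∙-congˡ (sum-cong-≋ (λ j → others (punchIn i j) (Fin.punchInᵢ≢i i j))) ⟩
    f i ∙ sum (λ (_ : Fin n) → ε)      ≈⟨ ∙-congˡ (sum-replicate-zero n) ⟩
    f i ∙ ε                            ≈⟨ identityʳ (f i) ⟩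
    f i                                ∎

-- The divided differences of a polynomial function of degree at most suc d are
-- polynomial functions of degree at most d with the same coefficient in top degree.
module Polynomial (S : CommutativeSemiring ℓ₀ ℓ) where
  open CommutativeSemiring S
  open import Algebra.Properties.CommutativeSemiring.Exp S renaming (_^_ to _↑_)
  open import Algebra.Solver.Ring.NaturalCoefficients.Default S

  -- f has degree at most d, and the coefficient of the d-th power is a. The equation
  -- says f x - f y ≈ (x - y) * g x without subtraction.
  HasLeadingTerm : ℕ → Carrier → (Carrier → Carrier) → Set (ℓ₀ ⊔ ℓ)
  HasLeadingTerm zero    a f = ∀ x → f x ≈ a
  HasLeadingTerm (suc d) a f =
    ∀ y → ∃[ g ] (HasLeadingTerm d a g × ∀ x → f x + y * g x ≈ f y + x * g x)

  raise : ∀ d {a f} → HasLeadingTerm d a f → HasLeadingTerm (suc d) 0# f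
  raise zero    hf y = (λ _ → 0#) , (λ _ → refl) , λ x →
    +-cong (trans (hf x) (sym (hf y))) (trans (zeroʳ y) (sym (zeroʳ x)))
  raise (suc d) hf y with hf y
  ... | g , hg , eq = g , raise d hg , eq

  raise-< : ∀ {d e a f} → d < e → HasLeadingTerm d a f → HasLeadingTerm e 0# f
  raise-< d<e = go (ℕ.≤⇒≤′ d<e)
    where
    go : ∀ {d e a f} → suc d ℕ.≤′ e → HasLeadingTerm d a f → HasLeadingTerm e 0# f
    go (ℕ.≤′-reflexive ≡.refl) hf = raise _ hf
    go (ℕ.≤′-step d<e)         hf = raise _ (go d<e hf)

  resp : ∀ d {a b f} → a ≈ b → HasLeadingTerm d a f → HasLeadingTerm d b f
  resp zero    a≈b hf x = trans (hf x) a≈b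
  resp (suc d) a≈b hf y with hf y
  ... | g , hg , eq = g , resp d a≈b hg , eq

  add : ∀ d {a b f g} → HasLeadingTerm d a f → HasLeadingTerm d b g →
        HasLeadingTerm d (a + b) (λ x → f x + g x)
  add zero    hf hg x = +-cong (hf x) (hg x)
  add (suc d) {f = f} {g = g} hf hg y with hf y | hg y
  ... | f′ , hf′ , eq | g′ , hg′ , eq′ = (λ x → f′ x + g′ x) , add d hf′ hg′ , λ x → trans
    (solve 5 (λ u v y u′ v′ → (u :+ v) :+ y :* (u′ :+ v′) := (u :+ y :* u′) :+ (v :+ y :* v′))
      refl (f x) (g x) y (f′ x) (g′ x))
    (trans (+-cong (eq x) (eq′ x))
    (solve 5 (λ u v y u′ v′ → (u :+ y :* u′) :+ (v :+ y :* v′) := (u :+ v) :+ y :* (u′ :+ v′))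
      refl (f y) (g y) x (f′ x) (g′ x)))

  scale : ∀ d k {a f} → HasLeadingTerm d a f → HasLeadingTerm d (k * a) (λ x → k * f x)
  scale zero    k hf x = *-congˡ (hf x)
  scale (suc d) k {f = f} hf y with hf y
  ... | f′ , hf′ , eq = (λ x → k * f′ x) , scale d k hf′ , λ x → trans
    (solve 4 (λ k u y u′ → k :* u :+ y :* (k :* u′) := k :* (u :+ y :* u′)) refl k (f x) y (f′ x))
    (trans (*-congˡ (eq x))
    (solve 4 (λ k u y u′ → k :* (u :+ y :* u′) := k :* u :+ y :* (k :* u′)) refl k (f y) x (f′ x)))

  power : ∀ d → HasLeadingTerm d 1# (_↑ d)
  power zero          x = refl
  power (suc zero)    y = (λ _ → 1#) , (λ _ → refl) , λ x →
    solve 2 (λ x y → x :* con 1 :+ y :* con 1 := y :* con 1 :+ x :* con 1) refl x y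
  power (suc (suc d)) y =
    let h , hh , eq = power (suc d) y in
    -- The divided difference of x ^ (d + 2), from h, that of x ^ (d + 1). The summand `y * h x` has
    -- degree at most d and leaves the leading coefficient 1 unchanged.
    (λ x → x ↑ suc d + y * h x) ,
    resp (suc d) (trans (+-congˡ (zeroʳ y)) (+-identityʳ 1#))
      (add (suc d) (power (suc d)) (scale (suc d) y (raise d hh))) ,
    λ x → trans (+-congˡ (*-congˡ (eq x)))
      (solve 5 (λ x y p r h → x :* p :+ y :* (r :+ x :* h) := y :* r :+ x :* (p :+ y :* h))
        refl x y (x ↑ suc d) (y ↑ suc d) (h x))

-- Finite fields: permutations of the elements, and counting of roots

module FiniteField (K : HeytingField ℓ₀ ℓ₁ ℓ₂) {n} (order : HasOrder (HeytingField._≈_ K) n) where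
  private module K = HeytingField K

  open CommutativeRing (HeytingCommutativeRing.commutativeRing K.heytingCommutativeRing) hiding (zero)
  open import Algebra.Properties.CommutativeSemiring.Exp commutativeSemiring
    renaming (_^_ to _↑_)
  open import Algebra.Properties.Semiring.Mult semiring using (×1-homo-*) renaming (_×_ to _⋆_)
  open import Algebra.Properties.Ring ring using (+-cancelˡ; -0#≈0#)
  open import Relation.Binary.Reasoning.Setoid setoid
  open Polynomial commutativeSemiring using (HasLeadingTerm)

  element : Fin n → Carrier
  element = proj₁ order

  element-injective : ∀ {i j} → element i ≈ element j → i ≡ j
  element-injective = proj₁ (proj₂ order)

  index : Carrier → Fin n
  index x = proj₁ (proj₂ (proj₂ order) x)

  element-index : ∀ x → element (index x) ≈ x
  element-index x = proj₂ (proj₂ (proj₂ order) x) ≡.refl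

  infix 4 _≟_
  _≟_ : ∀ x y → Dec (x ≈ y)
  x ≟ y with index x Fin.≟ index y
  ... | yes i≡j = yes (begin
    x                 ≈⟨ element-index x ⟨
    element (index x) ≡⟨ ≡.cong element i≡j ⟩
    element (index y) ≈⟨ element-index y ⟩
    y                 ∎)
  ... | no  i≢j = no λ x≈y → i≢j (element-injective
    (trans (element-index x) (trans x≈y (sym (element-index y)))))

  -- A Heyting field inverts only what is apart from 0. The finite search for an inverse is
  -- decidable, and its failure would refute apartness from 0, so that tightness would give x ≈ 0.
  inverse : ∀ {x} → x ≉ 0# → ∃[ y ] x * y ≈ 1#
  inverse {x} x≉0 with Fin.any? (λ i → x * element i ≟ 1#)
  ... | yes (i , x*y≈1) = element i , x*y≈1
  ... | no  ∄           = contradiction (proj₁ (K.tight x 0#) ¬x#0) x≉0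
    where
    ¬x#0 : ¬ (x K.# 0#)
    ¬x#0 x#0 with K.#⇒invertible x#0
    ... | y , _ , [x-0]y≈1 = ∄ (index y , (begin
      x * element (index y) ≈⟨ *-cong (sym (trans (+-congˡ -0#≈0#) (+-identityʳ x))) (element-index y) ⟩
      (x - 0#) * y          ≈⟨ [x-0]y≈1 ⟩
      1#                    ∎))

  1≉0 : 1# ≉ 0#
  1≉0 = Geometry.1≉0 K 0 0

  *-cancelˡ : ∀ {x y z} → x ≉ 0# → x * y ≈ x * z → y ≈ z
  *-cancelˡ {x} {y} {z} x≉0 xy≈xz with inverse x≉0
  ... | i , xi≈1 = begin
    y           ≈⟨ unit y ⟨
    i * (x * y) ≈⟨ *-congˡ xy≈xz ⟩
    i * (x * z) ≈⟨ unit z ⟩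
    z           ∎
    where
    unit : ∀ w → i * (x * w) ≈ w
    unit w = trans (sym (*-assoc i x w)) (trans (*-congʳ (trans (*-comm i x) xi≈1)) (*-identityˡ w))

  xy≈0⇒y≈0 : ∀ {x y} → x ≉ 0# → x * y ≈ 0# → y ≈ 0#
  xy≈0⇒y≈0 {x} x≉0 xy≈0 = *-cancelˡ x≉0 (trans xy≈0 (sym (zeroʳ x)))

  x*y≉0 : ∀ {x y} → x ≉ 0# → y ≉ 0# → x * y ≉ 0#
  x*y≉0 x≉0 y≉0 xy≈0 = y≉0 (xy≈0⇒y≈0 x≉0 xy≈0)

  x²≈0⇒x≈0 : ∀ {x} → x * x ≈ 0# → x ≈ 0#
  x²≈0⇒x≈0 {x} xx≈0 = decidable-stable (x ≟ 0#) λ x≉0 → x*y≉0 x≉0 x≉0 xx≈0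

  x^n≉0 : ∀ {x} n → x ≉ 0# → x ↑ n ≉ 0#
  x^n≉0 zero    x≉0 = 1≉0
  x^n≉0 (suc n) x≉0 = x*y≉0 x≉0 (x^n≉0 n x≉0)

  module Permuted {a ℓ} (M : CommutativeMonoid a ℓ) where
    private module M = CommutativeMonoid M
    open FiniteSum M

    -- Stated for any commutative monoid, so that it serves both the sum of all elements and the
    -- product of the nonzero ones.
    sum-bijection : (f : Carrier → M.Carrier) → (∀ {x y} → x ≈ y → f x M.≈ f y) →
                    (h h⁻¹ : Carrier → Carrier) →
                    (∀ {x y} → x ≈ y → h x ≈ h y) → (∀ {x y} → x ≈ y → h⁻¹ x ≈ h⁻¹ y) →
                    (∀ x → h (h⁻¹ x) ≈ x) → (∀ x → h⁻¹ (h x) ≈ x) →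
                    sum (λ i → f (element i)) M.≈ sum (λ i → f (h (element i)))
    sum-bijection f f-cong h h⁻¹ h-cong h⁻¹-cong hh⁻¹ h⁻¹h = M.trans
      (sum-permute (λ i → f (element i)) π)
      (sum-cong-≋ (λ i → f-cong (element-index (h (element i)))))
      where
      lift : (Carrier → Carrier) → Fin n → Fin n
      lift k i = index (k (element i))

      lift-inverse : (k l : Carrier → Carrier) → (∀ {x y} → x ≈ y → k x ≈ k y) →
                     (∀ x → k (l x) ≈ x) → ∀ i → lift k (lift l i) ≡ i
      lift-inverse k l k-cong kl i = element-injective (begin
        element (lift k (lift l i)) ≈⟨ element-index _ ⟩
        k (element (lift l i))      ≈⟨ k-cong (element-index _) ⟩
        k (l (element i))           ≈⟨ kl (element i) ⟩
        element i                   ∎)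

      π : Permutation′ n
      π = permutation (lift h) (lift h⁻¹)
            (lift-inverse h h⁻¹ h-cong hh⁻¹) (lift-inverse h⁻¹ h h⁻¹-cong h⁻¹h)

  -- The translation by 1 permutes the field, so it preserves the sum of all elements.
  order⋆1≈0 : n ⋆ 1# ≈ 0#
  order⋆1≈0 = +-cancelˡ (sum element) _ _ (begin
    sum element + n ⋆ 1#               ≈⟨ +-congˡ (sum-replicate n) ⟨
    sum element + sum {n} (λ _ → 1#)   ≈⟨ ∑-distrib-+ element (λ _ → 1#) ⟨
    sum (λ i → element i + 1#)
      ≈⟨ Permuted.sum-bijection +-commutativeMonoid (λ x → x) (λ x≈y → x≈y) (_+ 1#) (_- 1#) +-congʳ +-congʳ
           (cancel (-‿inverseˡ 1#)) (cancel (-‿inverseʳ 1#)) ⟨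
    sum element                        ≈⟨ +-identityʳ _ ⟨
    sum element + 0#                   ∎)
    where
    open FiniteSum +-commutativeMonoid

    cancel : ∀ {y z} → y + z ≈ 0# → ∀ x → (x + y) + z ≈ x
    cancel y+z≈0 x = trans (+-assoc x _ _) (trans (+-congˡ y+z≈0) (+-identityʳ x))

  -- Here `n ⋆ 1#` is the k-th power of 1 + 1, and a field has no nonzero nilpotent elements.
  characteristic2 : ∀ k → n ≡ 2 ^ k → 1# + 1# ≈ 0#
  characteristic2 k n≡2^k = decidable-stable (1# + 1# ≟ 0#) λ 2≉0 →
    2^k≉0 2≉0 k (≡.subst (λ n → n ⋆ 1# ≈ 0#) n≡2^k order⋆1≈0)
    where
    2^k≉0 : 1# + 1# ≉ 0# → ∀ k → (2 ^ k) ⋆ 1# ≉ 0#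
    2^k≉0 2≉0 zero    1≈0 = 1≉0 (trans (sym (+-identityʳ 1#)) 1≈0)
    2^k≉0 2≉0 (suc k) e   = x*y≉0 (λ e → 2≉0 (trans (+-congˡ (sym (+-identityʳ 1#))) e)) (2^k≉0 2≉0 k)
      (trans (sym (×1-homo-* 2 (2 ^ k))) e)

  -- Multiplication by x permutes the field; in the product of all elements, 0 is
  -- replaced by 1.
  fermat : ∀ {x} → x ≉ 0# → x ↑ n ≈ x
  fermat {x} x≉0 = *-cancelˡ ∏≉0 (begin
    ∏ * x ↑ n                                             ≈⟨ *-comm ∏ _ ⟩
    x ↑ n * ∏                                             ≈⟨ *-congʳ (sum-replicate n) ⟨
    sum {n} (λ _ → x) * ∏
      ≈⟨ ∑-distrib-+ (λ _ → x) (λ i → nonzero (element i)) ⟨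
    sum (λ i → x * nonzero (element i))                   ≈⟨ sum-cong-≋ (λ i → scaled (element i)) ⟨
    sum (λ i → defect (element i) * nonzero (x * element i))
      ≈⟨ ∑-distrib-+ (λ i → defect (element i)) (λ i → nonzero (x * element i)) ⟩
    sum (λ i → defect (element i)) * sum (λ i → nonzero (x * element i))
      ≈⟨ *-cong ∏defect≈x (sym permuted) ⟩
    x * ∏                                                 ≈⟨ *-comm x ∏ ⟩
    ∏ * x                                                 ∎)
    where
    open FiniteSum *-commutativeMonoid

    x⁻¹ : Carrier
    x⁻¹ = proj₁ (inverse x≉0)

    xx⁻¹≈1 : x * x⁻¹ ≈ 1#
    xx⁻¹≈1 = proj₂ (inverse x≉0)

    nonzero : Carrier → Carrier
    nonzero y with y ≟ 0#
    ... | yes _ = 1#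
    ... | no  _ = y

    nonzero-cong : ∀ {y z} → y ≈ z → nonzero y ≈ nonzero z
    nonzero-cong {y} {z} y≈z with y ≟ 0# | z ≟ 0#
    ... | yes _   | yes _   = refl
    ... | yes y≈0 | no  z≉0 = contradiction (trans (sym y≈z) y≈0) z≉0
    ... | no  y≉0 | yes z≈0 = contradiction (trans y≈z z≈0) y≉0
    ... | no  _   | no  _   = y≈z

    nonzero≉0 : ∀ y → nonzero y ≉ 0#
    nonzero≉0 y with y ≟ 0#
    ... | yes _   = 1≉0
    ... | no  y≉0 = y≉0

    -- Multiplication by x does not alter the 1 that stands in for 0, so one factor x is missing
    -- there. This is why all n factors together give x ^ n ≈ x.
    defect : Carrier → Carrier
    defect y with y ≟ 0#
    ... | yes _ = x
    ... | no  _ = 1#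

    scaled : ∀ y → defect y * nonzero (x * y) ≈ x * nonzero y
    scaled y with y ≟ 0# | x * y ≟ 0#
    ... | yes _   | yes _    = refl
    ... | yes y≈0 | no  xy≉0 = contradiction (trans (*-congˡ y≈0) (zeroʳ x)) xy≉0
    ... | no  y≉0 | yes xy≈0 = contradiction xy≈0 (x*y≉0 x≉0 y≉0)
    ... | no  _   | no  _    = *-identityˡ _

    ∏ : Carrier
    ∏ = sum (λ i → nonzero (element i))

    ∏≉0 : ∏ ≉ 0#
    ∏≉0 = go (λ i → nonzero≉0 (element i))
      where
      go : ∀ {m} {f : Fin m → Carrier} → (∀ i → f i ≉ 0#) → sum f ≉ 0#
      go {zero}  f≉0 = 1≉0
      go {suc m} f≉0 = x*y≉0 (f≉0 zero) (go (λ i → f≉0 (suc i)))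

    ∏defect≈x : sum (λ i → defect (element i)) ≈ x
    ∏defect≈x = trans (sum-single (λ i → defect (element i)) (index 0#) others) atZero
      where
      others : ∀ j → j ≢ index 0# → defect (element j) ≈ 1#
      others j j≢ with element j ≟ 0#
      ... | yes e = contradiction (element-injective (trans e (sym (element-index 0#)))) j≢
      ... | no  _ = refl

      atZero : defect (element (index 0#)) ≈ x
      atZero with element (index 0#) ≟ 0#
      ... | yes _ = refl
      ... | no  e = contradiction (element-index 0#) e

    permuted : ∏ ≈ sum (λ i → nonzero (x * element i))
    permuted = Permuted.sum-bijection *-commutativeMonoid nonzero nonzero-cong
      (x *_) (x⁻¹ *_) *-congˡ *-congˡ
      (λ y → trans (sym (*-assoc x x⁻¹ y)) (trans (*-congʳ xx⁻¹≈1) (*-identityˡ y)))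
      (λ y → trans (sym (*-assoc x⁻¹ x y)) (trans (*-congʳ (trans (*-comm x⁻¹ x) xx⁻¹≈1)) (*-identityˡ y)))

  -- Induction on the degree: if g is the divided difference at the root `p zero`, then z * g z ≈ p
  -- zero * g z at every other root z, so g vanishes there.
  vanishing⇒leading≈0 : ∀ d {a f} → HasLeadingTerm d a f → (p : Fin (suc d) → Carrier) →
                        (∀ {i j} → p i ≈ p j → i ≡ j) → (∀ i → f (p i) ≈ 0#) → a ≈ 0#
  vanishing⇒leading≈0 zero    hf p _     root = trans (sym (hf (p zero))) (root zero)
  vanishing⇒leading≈0 (suc d) {a} {f} hf p p-inj root with hf (p zero)
  ... | g , hg , eq = vanishing⇒leading≈0 d hg (λ i → p (suc i))
    (λ e → Fin.suc-injective (p-inj e)) g-root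
    where
    g-root : ∀ i → g (p (suc i)) ≈ 0#
    g-root i = decidable-stable (g z ≟ 0#) λ gz≉0 →
      contradiction (p-inj (*-cancelˡ gz≉0 (begin
        g z * p zero       ≈⟨ *-comm (g z) (p zero) ⟩
        p zero * g z       ≈⟨ +-identityˡ _ ⟨
        0# + p zero * g z  ≈⟨ +-congʳ (root (suc i)) ⟨
        f z + p zero * g z ≈⟨ eq z ⟩
        f (p zero) + z * g z ≈⟨ +-congʳ (root zero) ⟩
        0# + z * g z       ≈⟨ +-identityˡ _ ⟩
        z * g z            ≈⟨ *-comm z (g z) ⟩
        g z * z            ∎))) Fin.0≢1+n
      where z = p (suc i)

  nonroot : ∀ {d a f} → HasLeadingTerm d a f → d < n → a ≉ 0# → ∃[ x ] f x ≉ 0#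
  nonroot {d} {f = f} hf d<n a≉0 with Fin.any? (λ i → ¬? (f (element i) ≟ 0#))
  ... | yes (i , f≉0) = element i , f≉0
  ... | no  ∄         = contradiction
    (vanishing⇒leading≈0 d hf (λ i → element (inject≤ i d<n))
      (λ e → Fin.inject≤-injective d<n d<n _ _ (element-injective e))
      (λ i → decidable-stable (f (element (inject≤ i d<n)) ≟ 0#) λ f≉0 → ∄ (inject≤ i d<n , f≉0)))
    a≉0

-- Even prime powers and commutative rings of characteristic 2

even-primePower : ∀ {q} → IsPrimePower q → 2 ∣ q → ∃[ k ] q ≡ 2 ^ k
even-primePower {q} (p , k , p-prime , q≡p^k) 2∣q =
  suc k , ≡.trans q≡p^k (≡.cong (_^ suc k) (≡.sym (2≡p (prime⇒irreducible p-prime 2∣p))))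
  where
  2∣p^⇒2∣p : ∀ k → 2 ∣ p ^ suc k → 2 ∣ p
  2∣p^⇒2∣p zero    2∣ = ≡.subst (2 ∣_) (ℕ.*-identityʳ p) 2∣
  2∣p^⇒2∣p (suc k) 2∣ with euclidsLemma p (p ^ suc k) prime[2] 2∣
  ... | inj₁ 2∣p = 2∣p
  ... | inj₂ 2∣′ = 2∣p^⇒2∣p k 2∣′

  2∣p : 2 ∣ p
  2∣p = 2∣p^⇒2∣p k (≡.subst (2 ∣_) q≡p^k 2∣q)

  2≡p : 2 ≡ 1 ⊎ 2 ≡ p → 2 ≡ p
  2≡p (inj₂ eq) = eq

HasCharacteristic2 : CommutativeRing ℓ₀ ℓ → Set ℓ
HasCharacteristic2 R = 1# + 1# ≈ 0#
  where open CommutativeRing R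

module Characteristic2 (R : CommutativeRing ℓ₀ ℓ)
  (1+1≈0 : HasCharacteristic2 R) where
  open CommutativeRing R hiding (zero)
  open import Algebra.Properties.CommutativeSemiring.Exp commutativeSemiring
    using (^-assocʳ; ^-congˡ) renaming (_^_ to _↑_)
  open import Algebra.Properties.Ring ring using (-0#≈0#; +-inverseʳ-unique)
  open import Relation.Binary.Reasoning.Setoid setoid

  private
    𝔽₂ = CommutativeRing.rawRing xor-∧-commutativeRing

    embed : Bool → Carrier
    embed false = 0#
    embed true  = 1#

    embed-+ : ∀ x y → embed (x xor y) ≈ embed x + embed y
    embed-+ false y     = sym (+-identityˡ _)
    embed-+ true  false = sym (+-identityʳ _)
    embed-+ true  true  = sym 1+1≈0

    embed-* : ∀ x y → embed (x ∧ y) ≈ embed x * embed y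
    embed-* false y = sym (zeroˡ _)
    embed-* true  y = sym (*-identityˡ _)

    embed-neg : ∀ x → embed x ≈ - embed x
    embed-neg false = sym -0#≈0#
    embed-neg true  = +-inverseʳ-unique 1# 1# 1+1≈0

    embed-dec : ∀ x y → Maybe (embed x ≈ embed y)
    embed-dec x y with x Bool.≟ y
    ... | yes eq = just (reflexive (≡.cong embed eq))
    ... | no  _  = nothing

    embed-morphism : 𝔽₂ -Raw-AlmostCommutative⟶ fromCommutativeRing R
    embed-morphism = record
      { ⟦_⟧ = embed ; +-homo = embed-+ ; *-homo = embed-* ; -‿homo = embed-neg
      ; 0-homo = refl ; 1-homo = refl }

  -- With coefficients in 𝔽₂, the solver proves the identities valid in characteristic 2.
  open import Algebra.Solver.Ring 𝔽₂ (fromCommutativeRing R) embed-morphism embed-dec public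
    using (solve; _:=_; _:+_; _:*_; _:-_; con)

  x+x≈0 : ∀ x → x + x ≈ 0#
  x+x≈0 = solve 1 (λ x → x :+ x := con false) refl

  x+y≈0⇒x≈y : ∀ {x y} → x + y ≈ 0# → x ≈ y
  x+y≈0⇒x≈y {x} {y} x+y≈0 = begin
    x           ≈⟨ solve 2 (λ x y → x := (x :+ y) :+ y) refl x y ⟩
    (x + y) + y ≈⟨ +-congʳ x+y≈0 ⟩
    0# + y      ≈⟨ +-identityˡ y ⟩
    y           ∎

  frobenius : ∀ k x y → (x + y) ↑ (2 ^ k) ≈ x ↑ (2 ^ k) + y ↑ (2 ^ k)
  frobenius zero    x y = solve 2 (λ x y → (x :+ y) :* con true
      := x :* con true :+ y :* con true) refl x y
  frobenius (suc k) x y = begin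
    (x + y) ↑ (2 ℕ.* 2 ^ k)             ≈⟨ ^-assocʳ (x + y) 2 (2 ^ k) ⟨
    ((x + y) ↑ 2) ↑ (2 ^ k)
      ≈⟨ ^-congˡ (2 ^ k) (solve 2 (λ x y → (x :+ y) :* ((x :+ y) :* con true)
          := x :* (x :* con true) :+ y :* (y :* con true)) refl x y) ⟩
    (x ↑ 2 + y ↑ 2) ↑ (2 ^ k)           ≈⟨ frobenius k (x ↑ 2) (y ↑ 2) ⟩
    (x ↑ 2) ↑ (2 ^ k) + (y ↑ 2) ↑ (2 ^ k) ≈⟨ +-cong (^-assocʳ x 2 (2 ^ k)) (^-assocʳ y 2 (2 ^ k)) ⟩
    x ↑ (2 ℕ.* 2 ^ k) + y ↑ (2 ℕ.* 2 ^ k) ∎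

module EvenField (K : HeytingField ℓ₀ ℓ₁ ℓ₂) (q t : ℕ) (3≤q : 3 ≤ q) (1≤t : 1 ≤ t)
  (k : ℕ) (q≡2^k : q ≡ 2 ^ k)
  (order : HasOrder (HeytingField._≈_ K) (q ^ t)) where

  open Geometry K q t using (commutativeRing; norm)
  open CommutativeRing commutativeRing hiding (zero)
  open import Algebra.Properties.CommutativeSemiring.Exp commutativeSemiring
    renaming (_^_ to _↑_)
  open import Relation.Binary.Reasoning.Setoid setoid
  open FiniteField K order public
    using (_≟_; inverse; 1≉0; *-cancelˡ; xy≈0⇒y≈0; x*y≉0; x²≈0⇒x≈0; x^n≉0; fermat; nonroot)
  open FiniteField K order using (characteristic2)
  open Polynomial commutativeSemiring

  q^≡2^ : ∀ m → q ^ m ≡ 2 ^ (k ℕ.* m)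
  q^≡2^ m = ≡.trans (≡.cong (_^ m) q≡2^k) (ℕ.^-*-assoc 2 k m)

  open Characteristic2 commutativeRing (characteristic2 (k ℕ.* t) (q^≡2^ t)) public

  frobenius-q^ : ∀ m x y → (x + y) ↑ (q ^ m) ≈ x ↑ (q ^ m) + y ↑ (q ^ m)
  frobenius-q^ m x y = ≡.subst (λ e → (x + y) ↑ e ≈ x ↑ e + y ↑ e) (≡.sym (q^≡2^ m))
    (frobenius (k ℕ.* m) x y)

  frobenius-q : ∀ x y → (x + y) ↑ q ≈ x ↑ q + y ↑ q
  frobenius-q x y = ≡.subst (λ e → (x + y) ↑ e ≈ x ↑ e + y ↑ e) (ℕ.^-identityʳ q) (frobenius-q^ 1 x y)

  0^q≈0 : 0# ↑ q ≈ 0#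
  0^q≈0 = begin
    0# ↑ q          ≈⟨ ^-congˡ q (+-identityˡ 0#) ⟨
    (0# + 0#) ↑ q   ≈⟨ frobenius-q 0# 0# ⟩
    0# ↑ q + 0# ↑ q ≈⟨ x+x≈0 (0# ↑ q) ⟩
    0#              ∎

  fixed-q^ : ∀ {x} → x ↑ q ≈ x → ∀ m → x ↑ (q ^ m) ≈ x
  fixed-q^ {x} x^q≈x zero    = *-identityʳ x
  fixed-q^ {x} x^q≈x (suc m) = begin
    x ↑ (q ℕ.* q ^ m) ≈⟨ ^-assocʳ x q (q ^ m) ⟨
    (x ↑ q) ↑ (q ^ m) ≈⟨ ^-congˡ (q ^ m) x^q≈x ⟩
    x ↑ (q ^ m)       ≈⟨ fixed-q^ x^q≈x m ⟩
    x                 ∎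

  x^[q^t]≈x : ∀ x → x ↑ (q ^ t) ≈ x
  x^[q^t]≈x x with x ≟ 0#
  ... | no  x≉0 = fermat x≉0
  ... | yes x≈0 = begin
    x ↑ (q ^ t)  ≈⟨ ^-congˡ (q ^ t) x≈0 ⟩
    0# ↑ (q ^ t) ≈⟨ fixed-q^ 0^q≈0 t ⟩
    0#           ≈⟨ x≈0 ⟨
    x            ∎

  1^n≈1 : ∀ n → 1# ↑ n ≈ 1#
  1^n≈1 zero    = refl
  1^n≈1 (suc n) = trans (*-identityˡ _) (1^n≈1 n)

  x^m≈1⇒x^n≈1 : ∀ {x m n} → m ∣ n → x ↑ m ≈ 1# → x ↑ n ≈ 1#
  x^m≈1⇒x^n≈1 {x} {m} (divides r ≡.refl) x^m≈1 = begin
    x ↑ (r ℕ.* m) ≡⟨ ≡.cong (x ↑_) (ℕ.*-comm r m) ⟩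
    x ↑ (m ℕ.* r) ≈⟨ ^-assocʳ x m r ⟨
    (x ↑ m) ↑ r   ≈⟨ ^-congˡ r x^m≈1 ⟩
    1# ↑ r        ≈⟨ 1^n≈1 r ⟩
    1#            ∎

  norm-* : ∀ x y → norm (x * y) ≈ norm x * norm y
  norm-* x y = ^-distrib-* x y (geometricSum q t)

  norm-cong : ∀ {x y} → x ≈ y → norm x ≈ norm y
  norm-cong = ^-congˡ (geometricSum q t)

  -- The q-th power permutes the conjugates x, x ^ q, ... cyclically. The extra factor x on both
  -- sides replaces a division.
  norm-fixed : ∀ {x} → x ≉ 0# → norm x ↑ q ≈ norm x
  norm-fixed {x} x≉0 = *-cancelˡ x≉0 (begin
    x * norm x ↑ q                     ≈⟨ *-congˡ (^-assocʳ x g q) ⟩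
    x ↑ suc (g ℕ.* q)                  ≡⟨ ≡.cong (x ↑_) (geometricSum-shift q t) ⟩
    x ↑ (g ℕ.+ q ^ t)                  ≈⟨ ^-homo-* x g (q ^ t) ⟩
    norm x * x ↑ (q ^ t)               ≈⟨ *-congˡ (fermat x≉0) ⟩
    norm x * x                         ≈⟨ *-comm (norm x) x ⟩
    x * norm x                         ∎)
    where
    g = geometricSum q t

  -- The norms of nonzero elements lie in 𝔽_q, and by the degree of the norm they are
  -- not all 1.
  ∃-fixed≉0,1 : ∃[ β ] (β ≉ 0# × β ≉ 1# × β ↑ q ≈ β)
  ∃-fixed≉0,1 = norm x , x^n≉0 g x≉0 , norm≉1 , norm-fixed x≉0
    where
    g = geometricSum q t

    1<1+g : ∀ {t} → 1 ≤ t → 1 < 1 ℕ.+ geometricSum q t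
    1<1+g {suc _} _ = s≤s (s≤s z≤n)

    -- In characteristic 2 this is x (N(x) - 1), so a single non-root is both nonzero and of norm
    -- different from 1.
    found : ∃[ x ] (x ↑ suc g + x ↑ 1) ≉ 0#
    found = nonroot
      (resp (suc g) (+-identityʳ 1#)
        (add (suc g) (power (suc g)) (raise-< {e = suc g} (1<1+g 1≤t) (power 1))))
      (1+geometricSum<^ 3≤q 1≤t) 1≉0

    x = proj₁ found

    x≉0 : x ≉ 0#
    x≉0 x≈0 = proj₂ found (begin
      x * norm x + x * 1#   ≈⟨ +-cong (*-congʳ x≈0) (*-congʳ x≈0) ⟩
      0# * norm x + 0# * 1# ≈⟨ +-cong (zeroˡ _) (zeroˡ _) ⟩
      0# + 0#               ≈⟨ +-identityˡ 0# ⟩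
      0#                    ∎)

    norm≉1 : norm x ≉ 1#
    norm≉1 norm≈1 = proj₂ found (trans (+-congʳ (*-congˡ norm≈1)) (x+x≈0 (x * 1#)))

  norm-inverse≈1 : ∀ {κ ι} → κ * ι ≈ 1# → norm κ ≈ 1# → norm ι ≈ 1#
  norm-inverse≈1 {κ} {ι} κι≈1 norm≈1 = begin
    norm ι          ≈⟨ *-identityˡ _ ⟨
    1# * norm ι     ≈⟨ *-congʳ norm≈1 ⟨
    norm κ * norm ι ≈⟨ norm-* κ ι ⟨
    norm (κ * ι)    ≈⟨ norm-cong κι≈1 ⟩
    norm 1#         ≈⟨ 1^n≈1 (geometricSum q t) ⟩
    1#              ∎

  -- A nonzero value of the Lagrange resolvent.
  hilbert90 : ∀ {κ} → κ ≉ 0# → norm κ ≈ 1# → ∃[ γ ] (γ ≉ 0# × γ ↑ q ≈ κ * γ)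
  hilbert90 {κ} κ≉0 norm≈1 = resolvent t θ , γ≉0 , +-cancelʳ (κ * θ) _ _ (begin
    resolvent t θ ↑ q + κ * θ            ≈⟨ resolvent-^q t θ ⟩
    κ * (resolvent t θ + term t θ)       ≈⟨ *-congˡ (+-congˡ term-t) ⟩
    κ * (resolvent t θ + θ)              ≈⟨ distribˡ κ _ _ ⟩
    κ * resolvent t θ + κ * θ            ∎)
    where
    open import Algebra.Properties.Ring ring using (+-cancelʳ)

    ι = proj₁ (inverse κ≉0)
    κι≈1 = proj₂ (inverse κ≉0)

    -- The coefficient of term j is the product of the first j conjugates of κ⁻¹, chosen so that the
    -- q-th power turns term j into κ times term j + 1.
    term resolvent : ℕ → Carrier → Carrier
    term j θ = ι ↑ geometricSum q j * θ ↑ (q ^ j)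

    resolvent zero    θ = 0#
    resolvent (suc j) θ = resolvent j θ + term j θ

    term-^q : ∀ j θ → term j θ ↑ q ≈ κ * term (suc j) θ
    term-^q j θ = begin
      (ι ↑ g * θ ↑ (q ^ j)) ↑ q             ≈⟨ ^-distrib-* _ _ q ⟩
      (ι ↑ g) ↑ q * (θ ↑ (q ^ j)) ↑ q       ≈⟨ *-cong (^-assocʳ ι g q) (^-assocʳ θ (q ^ j) q) ⟩
      ι ↑ (g ℕ.* q) * θ ↑ (q ^ j ℕ.* q)
        ≡⟨ ≡.cong₂ (λ d e → ι ↑ d * θ ↑ e) (ℕ.*-comm g q) (ℕ.*-comm (q ^ j) q) ⟩
      ι ↑ (q ℕ.* g) * θ ↑ (q ^ suc j)       ≈⟨ *-identityˡ _ ⟨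
      1# * (ι ↑ (q ℕ.* g) * θ ↑ (q ^ suc j)) ≈⟨ *-congʳ κι≈1 ⟨
      (κ * ι) * (ι ↑ (q ℕ.* g) * θ ↑ (q ^ suc j))
        ≈⟨ solve 4 (λ κ ι e f → (κ :* ι) :* (e :* f) := κ :* ((ι :* e) :* f)) refl κ ι _ _ ⟩
      κ * (ι ↑ (1 ℕ.+ q ℕ.* g) * θ ↑ (q ^ suc j))
        ≡⟨ ≡.cong (λ e → κ * (ι ↑ e * θ ↑ (q ^ suc j))) (geometricSum-suc q j) ⟨
      κ * term (suc j) θ                    ∎
      where g = geometricSum q j

    -- The q-th power shifts every term by one; the summand `κ * θ` restores the lost term 0. For j
    -- = t the new term on the right is θ again.
    resolvent-^q : ∀ j θ → resolvent j θ ↑ q + κ * θ ≈ κ * (resolvent j θ + term j θ)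
    resolvent-^q zero    θ = trans (+-congʳ 0^q≈0)
      (solve 2 (λ κ θ → con false :+ κ :* θ
          := κ :* (con false :+ con true :* (θ :* con true))) refl κ θ)
    resolvent-^q (suc j) θ = begin
      (r + s) ↑ q + κ * θ                  ≈⟨ +-congʳ (frobenius-q r s) ⟩
      (r ↑ q + s ↑ q) + κ * θ
        ≈⟨ solve 3 (λ r s z → (r :+ s) :+ z := (r :+ z) :+ s) refl (r ↑ q) (s ↑ q) (κ * θ) ⟩
      (r ↑ q + κ * θ) + s ↑ q              ≈⟨ +-cong (resolvent-^q j θ) (term-^q j θ) ⟩
      κ * (r + s) + κ * term (suc j) θ     ≈⟨ distribˡ κ _ _ ⟨
      κ * ((r + s) + term (suc j) θ)       ∎
      where
      r = resolvent j θ
      s = term j θ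

    term-t : ∀ {θ} → term t θ ≈ θ
    term-t {θ} = begin
      norm ι * θ ↑ (q ^ t) ≈⟨ *-cong (norm-inverse≈1 κι≈1 norm≈1) (x^[q^t]≈x θ) ⟩
      1# * θ               ≈⟨ *-identityˡ θ ⟩
      θ                    ∎

    1<q : 1 < q
    1<q = ℕ.<-trans (ℕ.n<1+n 1) 3≤q

    -- As a polynomial in θ the resolvent has degree q ^ (t - 1) and a nonzero leading coefficient.
    -- This takes the place of the linear independence of the powers of Frobenius.
    leading : ∀ j → HasLeadingTerm (q ^ j) (ι ↑ geometricSum q j) (resolvent (suc j))
    leading j = resp (q ^ j) (trans (+-identityˡ _) (*-identityʳ _))
      (add (q ^ j) (lower j) (scale (q ^ j) (ι ↑ geometricSum q j) (power (q ^ j))))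
      where
      lower : ∀ j → HasLeadingTerm (q ^ j) 0# (resolvent j)
      lower zero    = raise 0 (λ _ → refl)
      lower (suc j) = raise-< (ℕ.^-monoʳ-< q 1<q (ℕ.n<1+n j)) (leading j)

    found : ∃[ θ ] resolvent t θ ≉ 0#
    found = at t 1≤t ≡.refl
      where
      ι≉0 : ι ≉ 0#
      ι≉0 ι≈0 = 1≉0 (trans (sym κι≈1) (trans (*-congˡ ι≈0) (zeroʳ κ)))

      at : ∀ s → 1 ≤ s → s ≡ t → ∃[ θ ] resolvent s θ ≉ 0#
      at (suc j) _ s≡t = nonroot (leading j)
        (≡.subst (λ s → q ^ j < q ^ s) s≡t (ℕ.^-monoʳ-< q 1<q (ℕ.n<1+n j)))
        (x^n≉0 (geometricSum q j) ι≉0)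

    θ = proj₁ found
    γ≉0 = proj₂ found

  norm-^≈1 : ∀ {x} e → norm x ≈ 1# → norm (x ↑ e) ≈ 1#
  norm-^≈1 {x} e norm≈1 =
    trans (^-assocʳ x e (geometricSum q t)) (x^m≈1⇒x^n≈1 (divides e ≡.refl) norm≈1)

  -- Since gcd(m , t) = 1, raising to the power 1 + q + ⋯ + q ^ (m - 1) permutes the
  -- elements of norm 1.
  norm1-root : ∀ {κ m} → Coprime m t → κ ≉ 0# → norm κ ≈ 1# →
               ∃[ μ ] (μ ≉ 0# × norm μ ≈ 1# × μ ↑ geometricSum q m ≈ κ)
  norm1-root {κ} {m} coprime κ≉0 norm≈1 with coprime-Bézout coprime
  -- Write [n] for 1 + q + ⋯ + q ^ (n - 1). Then [x m] = 1 + q [y t], and [t] divides [y t], so κ ^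
  -- [x m] = κ; as [x m] = s [m], the root is κ ^ s.
  ... | Bézout.+- x y 1+yt≡xm with geometricSum-∣ q x m
  ... | divides s [xm]≡s[m] = κ ↑ s , x^n≉0 s κ≉0 , norm-^≈1 s norm≈1 , (begin
    (κ ↑ s) ↑ geometricSum q m            ≈⟨ ^-assocʳ κ s _ ⟩
    κ ↑ (s ℕ.* geometricSum q m)          ≡⟨ ≡.cong (κ ↑_) [xm]≡s[m] ⟨
    κ ↑ geometricSum q (x ℕ.* m)          ≡⟨ ≡.cong (λ e → κ ↑ geometricSum q e) 1+yt≡xm ⟨
    κ ↑ geometricSum q (1 ℕ.+ y ℕ.* t)    ≡⟨ ≡.cong (κ ↑_) (geometricSum-suc q (y ℕ.* t)) ⟩
    κ * κ ↑ (q ℕ.* geometricSum q (y ℕ.* t))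
      ≈⟨ *-congˡ (x^m≈1⇒x^n≈1 (∣n⇒∣m*n q (geometricSum-∣ q y t)) norm≈1) ⟩
    κ * 1#                                ≈⟨ *-identityʳ κ ⟩
    κ                                     ∎)
  norm1-root {κ} {m} coprime κ≉0 norm≈1 | Bézout.-+ x y 1+xm≡yt with geometricSum-∣ q x m | inverse κ≉0
  -- With the other sign, 1 + q [x m] = [y t] annihilates ι = κ⁻¹, so ι ^ (q [x m]) = κ and the root
  -- is ι ^ (q s).
  ... | divides s [xm]≡s[m] | ι , κι≈1 = ι ↑ (q ℕ.* s) , x^n≉0 (q ℕ.* s) ι≉0 ,
    norm-^≈1 (q ℕ.* s) norm-ι≈1 , (begin
    (ι ↑ (q ℕ.* s)) ↑ geometricSum q m    ≈⟨ ^-assocʳ ι (q ℕ.* s) _ ⟩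
    ι ↑ (q ℕ.* s ℕ.* geometricSum q m)
      ≡⟨ ≡.cong (ι ↑_) (≡.trans (ℕ.*-assoc q s _) (≡.cong (q ℕ.*_) (≡.sym [xm]≡s[m]))) ⟩
    ι ↑ e                                 ≈⟨ *-identityˡ _ ⟨
    1# * ι ↑ e                            ≈⟨ *-congʳ κι≈1 ⟨
    (κ * ι) * ι ↑ e                       ≈⟨ *-assoc κ ι _ ⟩
    κ * ι ↑ suc e                         ≡⟨ ≡.cong (λ e → κ * ι ↑ e) (geometricSum-suc q (x ℕ.* m)) ⟨
    κ * ι ↑ geometricSum q (1 ℕ.+ x ℕ.* m) ≡⟨ ≡.cong (λ e → κ * ι ↑ geometricSum q e) 1+xm≡yt ⟩
    κ * ι ↑ geometricSum q (y ℕ.* t)      ≈⟨ *-congˡ (x^m≈1⇒x^n≈1 (geometricSum-∣ q y t) norm-ι≈1) ⟩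
    κ * 1#                                ≈⟨ *-identityʳ κ ⟩
    κ                                     ∎)
    where
    e = q ℕ.* geometricSum q (x ℕ.* m)

    norm-ι≈1 : norm ι ≈ 1#
    norm-ι≈1 = norm-inverse≈1 κι≈1 norm≈1

    ι≉0 : ι ≉ 0#
    ι≉0 ι≈0 = 1≉0 (trans (sym κι≈1) (trans (*-congˡ ι≈0) (zeroʳ κ)))

  γ^q≈μγ⇒γ^[q^m] : ∀ {γ μ} → γ ↑ q ≈ μ * γ → ∀ m → γ ↑ (q ^ m) ≈ μ ↑ geometricSum q m * γ
  γ^q≈μγ⇒γ^[q^m] {γ} {μ} γ^q≈μγ zero    = *-comm γ 1#
  γ^q≈μγ⇒γ^[q^m] {γ} {μ} γ^q≈μγ (suc m) = begin
    γ ↑ (q ℕ.* q ^ m)         ≡⟨ ≡.cong (γ ↑_) (ℕ.*-comm q (q ^ m)) ⟩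
    γ ↑ (q ^ m ℕ.* q)         ≈⟨ ^-assocʳ γ (q ^ m) q ⟨
    (γ ↑ (q ^ m)) ↑ q         ≈⟨ ^-congˡ q (γ^q≈μγ⇒γ^[q^m] γ^q≈μγ m) ⟩
    (μ ↑ g * γ) ↑ q           ≈⟨ ^-distrib-* _ γ q ⟩
    (μ ↑ g) ↑ q * γ ↑ q       ≈⟨ *-cong (^-assocʳ μ g q) γ^q≈μγ ⟩
    μ ↑ (g ℕ.* q) * (μ * γ)   ≡⟨ ≡.cong (λ e → μ ↑ e * (μ * γ)) (ℕ.*-comm g q) ⟩
    μ ↑ (q ℕ.* g) * (μ * γ)   ≈⟨ solve 3 (λ e μ γ → e :* (μ :* γ) := (μ :* e) :* γ) refl _ μ γ ⟩
    μ ↑ suc (q ℕ.* g) * γ     ≡⟨ ≡.cong (λ e → μ ↑ e * γ) (geometricSum-suc q m) ⟨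
    μ ↑ geometricSum q (suc m) * γ ∎
    where g = geometricSum q m

  -- Iterating γ ^ q = μ γ m times multiplies γ by μ ^ (1 + q + ⋯ + q ^ (m - 1)), so it suffices to
  -- choose μ of norm 1 for which this power is κ.
  hilbert90-twisted : ∀ {κ m} → Coprime m t → κ ≉ 0# → norm κ ≈ 1# →
                      ∃[ γ ] (γ ≉ 0# × γ ↑ (q ^ m) ≈ κ * γ)
  hilbert90-twisted {κ} {m} coprime κ≉0 norm≈1 with norm1-root coprime κ≉0 norm≈1
  ... | μ , μ≉0 , norm-μ≈1 , μ^[m]≈κ with hilbert90 μ≉0 norm-μ≈1
  ... | γ , γ≉0 , γ^q≈μγ = γ , γ≉0 , trans (γ^q≈μγ⇒γ^[q^m] γ^q≈μγ m) (*-congʳ μ^[m]≈κ)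

  equalNorms⇒conjugate : ∀ {θ₁ θ₂ m} → Coprime m t → θ₁ ≉ 0# → θ₂ ≉ 0# → norm θ₁ ≈ norm θ₂ →
                         ∃[ γ ] (γ ≉ 0# × γ ↑ (q ^ m) * θ₂ ≈ θ₁ * γ)
  equalNorms⇒conjugate {θ₁} {θ₂} {m} coprime θ₁≉0 θ₂≉0 norms =
    let γ , γ≉0 , γ^σ≈κγ = hilbert90-twisted coprime κ≉0 norm≈1 in
    γ , γ≉0 , (begin
      γ ↑ (q ^ m) * θ₂    ≈⟨ *-congʳ γ^σ≈κγ ⟩
      ((θ₁ * ι) * γ) * θ₂
        ≈⟨ solve 4 (λ θ₁ ι γ θ₂ → ((θ₁ :* ι) :* γ) :* θ₂ := ((θ₁ :* ι) :* θ₂) :* γ) refl θ₁ ι γ θ₂ ⟩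
      ((θ₁ * ι) * θ₂) * γ ≈⟨ *-congʳ κθ₂≈θ₁ ⟩
      θ₁ * γ              ∎)
    where
    ι = proj₁ (inverse θ₂≉0)

    κθ₂≈θ₁ : (θ₁ * ι) * θ₂ ≈ θ₁
    κθ₂≈θ₁ = begin
      (θ₁ * ι) * θ₂ ≈⟨ solve 3 (λ θ₁ ι θ₂ → (θ₁ :* ι) :* θ₂ := θ₁ :* (θ₂ :* ι)) refl θ₁ ι θ₂ ⟩
      θ₁ * (θ₂ * ι) ≈⟨ *-congˡ (proj₂ (inverse θ₂≉0)) ⟩
      θ₁ * 1#       ≈⟨ *-identityʳ θ₁ ⟩
      θ₁            ∎

    κ≉0 : θ₁ * ι ≉ 0#
    κ≉0 κ≈0 = θ₁≉0 (trans (sym κθ₂≈θ₁) (trans (*-congʳ κ≈0) (zeroˡ θ₂)))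

    norm≈1 : norm (θ₁ * ι) ≈ 1#
    norm≈1 = *-cancelˡ (x^n≉0 (geometricSum q t) θ₂≉0) (begin
      norm θ₂ * norm (θ₁ * ι)   ≈⟨ *-comm (norm θ₂) (norm (θ₁ * ι)) ⟩
      norm (θ₁ * ι) * norm θ₂   ≈⟨ norm-* (θ₁ * ι) θ₂ ⟨
      norm ((θ₁ * ι) * θ₂)      ≈⟨ norm-cong κθ₂≈θ₁ ⟩
      norm θ₁                   ≈⟨ norms ⟩
      norm θ₂                   ≈⟨ *-identityʳ (norm θ₂) ⟨
      norm θ₂ * 1#              ∎)

  -- Take u = θ b / b ^ (q ^ m). The quotient b / b ^ (q ^ m) has norm 1, since the norm commutes
  -- with powers and its nonzero values are fixed by the q-th power.
  twist : ∀ m {θ b} → θ ≉ 0# → b ≉ 0# →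
          ∃[ u ] (u ≉ 0# × norm u ≈ norm θ × b ↑ (q ^ m) * u ≈ θ * b)
  twist m {θ} {b} θ≉0 b≉0 with inverse b≉0
  ... | b⁻¹ , bb⁻¹≈1 = θ * (b * b⁻¹ ↑ (q ^ m)) ,
    x*y≉0 θ≉0 (x*y≉0 b≉0 (x^n≉0 (q ^ m) b⁻¹≉0)) , norm-u , (begin
      b ↑ (q ^ m) * (θ * (b * b⁻¹ ↑ (q ^ m)))
        ≈⟨ solve 4 (λ s θ b s′ → s :* (θ :* (b :* s′)) := (θ :* b) :* (s :* s′)) refl _ θ b _ ⟩
      (θ * b) * (b ↑ (q ^ m) * b⁻¹ ↑ (q ^ m)) ≈⟨ *-congˡ (^-distrib-* b b⁻¹ (q ^ m)) ⟨
      (θ * b) * (b * b⁻¹) ↑ (q ^ m)           ≈⟨ *-congˡ (^-congˡ (q ^ m) bb⁻¹≈1) ⟩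
      (θ * b) * 1# ↑ (q ^ m)                  ≈⟨ *-congˡ (1^n≈1 (q ^ m)) ⟩
      (θ * b) * 1#                            ≈⟨ *-identityʳ _ ⟩
      θ * b                                   ∎)
    where
    b⁻¹≉0 : b⁻¹ ≉ 0#
    b⁻¹≉0 b⁻¹≈0 = 1≉0 (trans (sym bb⁻¹≈1) (trans (*-congˡ b⁻¹≈0) (zeroʳ b)))

    g = geometricSum q t

    norm-σ : norm (b⁻¹ ↑ (q ^ m)) ≈ norm b⁻¹
    norm-σ = begin
      (b⁻¹ ↑ (q ^ m)) ↑ g   ≈⟨ ^-assocʳ b⁻¹ (q ^ m) g ⟩
      b⁻¹ ↑ (q ^ m ℕ.* g)   ≡⟨ ≡.cong (b⁻¹ ↑_) (ℕ.*-comm (q ^ m) g) ⟩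
      b⁻¹ ↑ (g ℕ.* q ^ m)   ≈⟨ ^-assocʳ b⁻¹ g (q ^ m) ⟨
      norm b⁻¹ ↑ (q ^ m)    ≈⟨ fixed-q^ (norm-fixed b⁻¹≉0) m ⟩
      norm b⁻¹              ∎

    norm-u : norm (θ * (b * b⁻¹ ↑ (q ^ m))) ≈ norm θ
    norm-u = begin
      norm (θ * (b * b⁻¹ ↑ (q ^ m)))          ≈⟨ norm-* θ _ ⟩
      norm θ * norm (b * b⁻¹ ↑ (q ^ m))       ≈⟨ *-congˡ (norm-* b _) ⟩
      norm θ * (norm b * norm (b⁻¹ ↑ (q ^ m))) ≈⟨ *-congˡ (*-congˡ norm-σ) ⟩
      norm θ * (norm b * norm b⁻¹)            ≈⟨ *-congˡ (norm-* b b⁻¹) ⟨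
      norm θ * norm (b * b⁻¹)                 ≈⟨ *-congˡ (norm-cong bb⁻¹≈1) ⟩
      norm θ * norm 1#                        ≈⟨ *-congˡ (1^n≈1 g) ⟩
      norm θ * 1#                             ≈⟨ *-identityʳ _ ⟩
      norm θ                                  ∎

-- Conics tangent to the line at infinity, in characteristic 2

module EvenPlane (K : HeytingField ℓ₀ ℓ₁ ℓ₂) (q t : ℕ) (3≤q : 3 ≤ q) (1≤t : 1 ≤ t)
  (k : ℕ) (q≡2^k : q ≡ 2 ^ k)
  (order : HasOrder (HeytingField._≈_ K) (q ^ t)) where

  open Geometry K q t hiding (_≈_; _≉_; Carrier; _+_; _*_; -_; _-_; 0#; 1#; semiring; _^_; 1≉0)
  open CommutativeRing commutativeRing hiding (zero)
  open import Algebra.Properties.CommutativeSemiring.Exp commutativeSemiring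
    renaming (_^_ to _↑_)
  open import Relation.Binary.Reasoning.Setoid setoid
  open EvenField K q t 3≤q 1≤t k q≡2^k order

  -- In characteristic 2 the expression `x * v + y * u` is the determinant of (x , y) and (u , v).
  independent : ∀ {x y} → ¬ (x ≈ 0# × y ≈ 0#) → ∃[ u ] ∃[ v ] x * v + y * u ≉ 0#
  independent {x} {y} xy≉0 with x ≟ 0# | y ≟ 0#
  ... | yes x≈0 | yes y≈0 = contradiction (x≈0 , y≈0) xy≉0
  ... | no  x≉0 | _       = 0# , 1# , λ e → x≉0 (trans
    (solve 2 (λ x y → x := x :* con true :+ y :* con false) refl x y) e)
  ... | yes _   | no  y≉0 = 1# , 0# , λ e → y≉0 (trans
    (solve 2 (λ x y → y := x :* con false :+ y :* con true) refl x y) e)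

  module TangentConic (𝒞 : Conic) (T : Point₁)
    (tangent : Conic.IsTangentAt 𝒞 ℓ∞ (infinitePoint T)) where
    open Conic 𝒞
    open QuadraticForm form

    t₁ = proj₁ (proj₁ T)
    t₂ = proj₂ (proj₁ T)

    -- The restriction of the form to the line at infinity, once h ≈ 0.
    diagonal : Carrier → Carrier → Carrier
    diagonal x y = a * (x * x) + b * (y * y)

    -- The determinant of (x , y) and the nucleus (f , g), in characteristic 2.
    pairing : Carrier → Carrier → Carrier
    pairing x y = g * x + f * y

    value-T≈0 : value (proj₁ T , 0#) ≈ 0#
    value-T≈0 = proj₁ tangent

    -- If (u , v) is independent of T, then S = Q(u , v) T + h (t₁ v + t₂ u) (u , v) is a
    -- point of the conic at infinity, so S ∼ T, so h ≈ 0.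
    h≈0 : h ≈ 0#
    h≈0 = decidable-stable (h ≟ 0#) h≉0⇒⊥
      where
      h≉0⇒⊥ : ¬ (h ≉ 0#)
      h≉0⇒⊥ h≉0 with independent (proj₂ T)
      ... | u , v , D≉0 = S≁T (proj₂ (proj₂ tangent) S S∈𝒞 S∈ℓ∞)
        where
        D = t₁ * v + t₂ * u
        r = a * (u * u) + b * (v * v) + h * (u * v)
        -- As T is a zero of the form Q, Q(λ T + μ (u , v)) = μ (λ h D + μ r). The choice λ = r, μ =
        -- h D makes the bracket a double, hence 0.
        x = r * t₁ + (h * D) * u
        y = r * t₂ + (h * D) * v

        -- The determinant of S and T. Being nonzero, it shows both that S is a point and that S
        -- differs from T.
        hDD≈ : x * t₂ + y * t₁ ≈ (h * D) * D
        hDD≈ = solve 6 (λ t₁ t₂ u v r e → (r :* t₁ :+ e :* u) :* t₂ :+ (r :* t₂ :+ e :* v) :* t₁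
            := e :* (t₁ :* v :+ t₂ :* u))
          refl t₁ t₂ u v r (h * D)

        hDD≉0 : (h * D) * D ≉ 0#
        hDD≉0 = x*y≉0 (x*y≉0 h≉0 D≉0) D≉0

        S : Point₂
        S = ((x , y) , 0#) , λ where
          ((x≈0 , y≈0) , _) → hDD≉0 (trans (sym hDD≈)
            (trans (+-cong (*-congʳ x≈0) (*-congʳ y≈0))
              (solve 2 (λ t₁ t₂ → con false :* t₂ :+ con false :* t₁ := con false) refl t₁ t₂)))

        S∈𝒞 : value ((x , y) , 0#) ≈ 0#
        S∈𝒞 = begin
          value ((x , y) , 0#)
            ≈⟨ solve 8 (λ a b c f g x y h →
                 a :* (x :* x) :+ b :* (y :* y) :+ c :* (con false :* con false)
                   :+ f :* (y :* con false) :+ g :* (x :* con false) :+ h :* (x :* y)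
                 := a :* (x :* x) :+ b :* (y :* y) :+ h :* (x :* y)) refl a b c f g x y h ⟩
          a * (x * x) + b * (y * y) + h * (x * y)
            ≈⟨ solve 9 (λ a b h t₁ t₂ u v r e →
                 let x = r :* t₁ :+ e :* u
                     y = r :* t₂ :+ e :* v in
                 a :* (x :* x) :+ b :* (y :* y) :+ h :* (x :* y)
                 := (r :* r) :* (a :* (t₁ :* t₁) :+ b :* (t₂ :* t₂) :+ h :* (t₁ :* t₂))
                    :+ (e :* r) :* (h :* (t₁ :* v :+ t₂ :* u))
                    :+ (e :* e) :* (a :* (u :* u) :+ b :* (v :* v) :+ h :* (u :* v)))
                      refl a b h t₁ t₂ u v r (h * D) ⟩
          (r * r) * (a * (t₁ * t₁) + b * (t₂ * t₂) + h * (t₁ * t₂))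
            + ((h * D) * r) * (h * D) + ((h * D) * (h * D)) * r
            ≈⟨ solve 3 (λ r z e → (r :* r) :* z :+ (e :* r) :* e :+ (e :* e) :* r
                := (r :* r) :* z) refl r _ (h * D) ⟩
          (r * r) * (a * (t₁ * t₁) + b * (t₂ * t₂) + h * (t₁ * t₂))
            ≈⟨ *-congˡ (solve 8 (λ a b c f g x y h →
                 a :* (x :* x) :+ b :* (y :* y) :+ h :* (x :* y)
                 := a :* (x :* x) :+ b :* (y :* y) :+ c :* (con false :* con false)
                   :+ f :* (y :* con false) :+ g :* (x :* con false) :+ h :* (x :* y))
                   refl a b c f g t₁ t₂ h) ⟩
          (r * r) * value (proj₁ T , 0#)
            ≈⟨ *-congˡ value-T≈0 ⟩
          (r * r) * 0#
            ≈⟨ zeroʳ (r * r) ⟩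
          0# ∎

        S∈ℓ∞ : S on₂ ℓ∞
        S∈ℓ∞ = solve 2 (λ x y → con false :* x :+ con false :* y :+ con true :* con false
            := con false) refl x y

        S≁T : ¬ proj₁ S ∼₂ proj₁ (infinitePoint T)
        S≁T (s , _ , ((x≈ , y≈) , _)) = hDD≉0 (begin
          (h * D) * D           ≈⟨ hDD≈ ⟨
          x * t₂ + y * t₁       ≈⟨ +-cong (*-congʳ x≈) (*-congʳ y≈) ⟩
          (s * t₁) * t₂ + (s * t₂) * t₁
            ≈⟨ solve 3 (λ s t₁ t₂ → (s :* t₁) :* t₂ :+ (s :* t₂) :* t₁ := con false) refl s t₁ t₂ ⟩
          0#                    ∎)

    value-affine : ∀ x y z → value ((x , y) , z) ≈ diagonal x y + c * (z * z) + z * pairing x y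
    value-affine x y z = begin
      value ((x , y) , z)
        ≈⟨ +-congˡ (trans (*-congʳ h≈0) (zeroˡ _)) ⟩
      a * (x * x) + b * (y * y) + c * (z * z) + f * (y * z) + g * (x * z) + 0#
        ≈⟨ solve 8 (λ a b c f g x y z →
             a :* (x :* x) :+ b :* (y :* y) :+ c :* (z :* z) :+ f :* (y :* z) :+ g :* (x :* z) :+ con false
             := a :* (x :* x) :+ b :* (y :* y) :+ c :* (z :* z) :+ z :* (g :* x :+ f :* y))
               refl a b c f g x y z ⟩
      diagonal x y + c * (z * z) + z * pairing x y ∎

    polar-formula : ∀ x y z x′ y′ z′ →
      polar ((x , y) , z) ((x′ , y′) , z′) ≈ z′ * pairing x y + z * pairing x′ y′
    polar-formula x y z x′ y′ z′ = begin
      polar ((x , y) , z) ((x′ , y′) , z′)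
        ≈⟨ +-cong (+-cong (value-affine _ _ _) (-‿cong (value-affine x y z))) (-‿cong (value-affine x′ y′ z′)) ⟩
      _ ≈⟨ solve 11 (λ a b c f g x y z x′ y′ z′ →
             let form x y z = a :* (x :* x) :+ b :* (y :* y) :+ c :* (z :* z) :+ z :* (g :* x :+ f :* y) in
             form (x :+ x′) (y :+ y′) (z :+ z′) :- form x y z :- form x′ y′ z′
             := z′ :* (g :* x :+ f :* y) :+ z :* (g :* x′ :+ f :* y′)) refl a b c f g x y z x′ y′ z′ ⟩
      z′ * pairing x y + z * pairing x′ y′ ∎

    diagonal-T≈0 : diagonal t₁ t₂ ≈ 0#
    diagonal-T≈0 = begin
      diagonal t₁ t₂
        ≈⟨ solve 3 (λ d c p → d := d :+ c :* (con false :* con false) :+ con false :* p) refl _ c _ ⟩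
      diagonal t₁ t₂ + c * (0# * 0#) + 0# * pairing t₁ t₂
        ≈⟨ value-affine t₁ t₂ 0# ⟨
      value (proj₁ T , 0#)
        ≈⟨ value-T≈0 ⟩
      0# ∎

    -- A vanishing pairing puts (x , y , 0) in the radical of the polar form, so a zero of the form
    -- there is singular. Nondegeneracy enters through this: T is not the nucleus, N is not on the
    -- conic, and the tangent at P has no second point.
    isotropic⇒0 : ∀ {x y} → diagonal x y ≈ 0# → pairing x y ≈ 0# → x ≈ 0# × y ≈ 0#
    isotropic⇒0 {x} {y} d≈0 p≈0 = proj₁ (nondegenerate {(x , y) , 0#} (on , λ where
      ((x′ , y′) , z′) → begin
        polar ((x , y) , 0#) ((x′ , y′) , z′)  ≈⟨ polar-formula x y 0# x′ y′ z′ ⟩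
        z′ * pairing x y + 0# * pairing x′ y′  ≈⟨ +-cong (*-congˡ p≈0) (zeroˡ _) ⟩
        z′ * 0# + 0#                           ≈⟨ trans (+-identityʳ _) (zeroʳ z′) ⟩
        0#                                     ∎))
      where
      on : value ((x , y) , 0#) ≈ 0#
      on = begin
        value ((x , y) , 0#)                              ≈⟨ value-affine x y 0# ⟩
        diagonal x y + c * (0# * 0#) + 0# * pairing x y
          ≈⟨ solve 3 (λ d c p → d :+ c :* (con false :* con false) :+ con false :* p := d) refl _ c _ ⟩
        diagonal x y                                      ≈⟨ d≈0 ⟩
        0#                                                ∎

    pairing-T≉0 : pairing t₁ t₂ ≉ 0#
    pairing-T≉0 p≈0 = proj₂ T (isotropic⇒0 diagonal-T≈0 p≈0)

    -- The affine point P = (c p⁻¹) T of the conic; the line through P and the nucleus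
    -- (f , g , 0) is its tangent, and meets the line at infinity only in the nucleus.
    p⁻¹ = proj₁ (inverse pairing-T≉0)
    p₁ = (c * p⁻¹) * t₁
    p₂ = (c * p⁻¹) * t₂

    value-P≈0 : value ((p₁ , p₂) , 1#) ≈ 0#
    value-P≈0 = begin
      value ((p₁ , p₂) , 1#)
        ≈⟨ value-affine p₁ p₂ 1# ⟩
      diagonal p₁ p₂ + c * (1# * 1#) + 1# * pairing p₁ p₂
        ≈⟨ solve 8 (λ a b c f g t₁ t₂ i →
             let x = (c :* i) :* t₁
                 y = (c :* i) :* t₂ in
             a :* (x :* x) :+ b :* (y :* y) :+ c :* (con true :* con true) :+ con true :* (g :* x :+ f :* y)
             := (c :* i) :* (c :* i) :* (a :* (t₁ :* t₁) :+ b :* (t₂ :* t₂)) :+ c :+ c :* ((g :* t₁ :+ f :* t₂) :* i))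
             refl a b c f g t₁ t₂ p⁻¹ ⟩
      (c * p⁻¹) * (c * p⁻¹) * diagonal t₁ t₂ + c + c * (pairing t₁ t₂ * p⁻¹)
        ≈⟨ +-cong (+-congʳ (*-congˡ diagonal-T≈0)) (*-congˡ (proj₂ (inverse pairing-T≉0))) ⟩
      (c * p⁻¹) * (c * p⁻¹) * 0# + c + c * 1#
        ≈⟨ solve 2 (λ c e → e :* con false :+ c :+ c :* con true := con false) refl c _ ⟩
      0# ∎

    tangentLine : Line₂
    tangentLine = ((g , f) , pairing p₁ p₂) , λ where
      ((g≈0 , f≈0) , _) → pairing-T≉0 (trans (+-cong (*-congʳ g≈0) (*-congʳ f≈0))
        (trans (+-cong (zeroˡ t₁) (zeroˡ t₂)) (+-identityˡ 0#)))

    isTangent : IsTangentAt tangentLine (affinePoint (p₁ , p₂))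
    isTangent = value-P≈0 , solve 4 (λ g f x y → g :* x :+ f :* y :+ (g :* x :+ f :* y) :* con true
        := con false) refl g f p₁ p₂ , unique
      where
      unique : ∀ P → P ∈ points → P on₂ tangentLine → proj₁ P ∼₂ ((p₁ , p₂) , 1#)
      unique (((x , y) , z) , P≉0) on𝒞 P∈line =
        z , z≉0 , ((x≈ , y≈) , sym (*-identityʳ z))
        where
        x₀ = x + z * p₁
        y₀ = y + z * p₂

        pairing≈0 : pairing x₀ y₀ ≈ 0#
        pairing≈0 = trans
          (solve 7 (λ g f x y z p₁ p₂ → g :* (x :+ z :* p₁) :+ f :* (y :+ z :* p₂)
            := g :* x :+ f :* y :+ (g :* p₁ :+ f :* p₂) :* z) refl g f x y z p₁ p₂)
          P∈line

        -- The vector (x₀ , y₀ , 0) is the difference of two zeros of the form, so its value reduces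
        -- to a polar term, and that is a multiple of its pairing.
        diagonal≈0 : diagonal x₀ y₀ ≈ 0#
        diagonal≈0 = begin
          diagonal x₀ y₀
            ≈⟨ solve 10 (λ a b c f g x y z p₁ p₂ →
                 let form x y z = a :* (x :* x) :+ b :* (y :* y) :+ c :* (z :* z) :+ z :* (g :* x :+ f :* y)
                     x₀ = x :+ z :* p₁
                     y₀ = y :+ z :* p₂ in
                 a :* (x₀ :* x₀) :+ b :* (y₀ :* y₀)
                 := form x y z :+ (z :* z) :* form p₁ p₂ (con true) :+ z :* (g :* x₀ :+ f :* y₀))
                 refl a b c f g x y z p₁ p₂ ⟩
          _ ≈⟨ +-cong (+-cong (sym (value-affine x y z)) (*-congˡ (sym (value-affine p₁ p₂ 1#)))) refl ⟩
          value ((x , y) , z) + (z * z) * value ((p₁ , p₂) , 1#) + z * pairing x₀ y₀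
            ≈⟨ +-cong (+-cong on𝒞 (*-congˡ value-P≈0)) (*-congˡ pairing≈0) ⟩
          0# + (z * z) * 0# + z * 0#
            ≈⟨ solve 1 (λ z → con false :+ (z :* z) :* con false :+ z :* con false
                := con false) refl z ⟩
          0# ∎

        x≈ : x ≈ z * p₁
        x≈ = x+y≈0⇒x≈y (proj₁ (isotropic⇒0 diagonal≈0 pairing≈0))

        y≈ : y ≈ z * p₂
        y≈ = x+y≈0⇒x≈y (proj₂ (isotropic⇒0 diagonal≈0 pairing≈0))

        z≉0 : z ≉ 0#
        z≉0 z≈0 = P≉0 ((trans x≈ (trans (*-congʳ z≈0) (zeroˡ p₁)) , trans y≈ (trans (*-congʳ z≈0) (zeroˡ p₂))) , z≈0)

    -- Conic points on a common block of the replacement net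

    module Secant (N : Point₁) (nucleus : IsNucleus (infinitePoint N))
      {D : Pred Point₁ ℓ₃} (χ : ReplacementChart D) (T∈D : T ∈ D)
      (N∈D : N ∈ D) (m : ℕ) (coprime : Coprime m t) where
      open ReplacementChart χ

      n₁ = proj₁ (proj₁ N)
      n₂ = proj₂ (proj₁ N)

      -- Since N is given at infinity, it takes a second tangent, the one at the affine point P, to
      -- locate it.
      pairing-N≈0 : pairing n₁ n₂ ≈ 0#
      pairing-N≈0 = trans
        (solve 2 (λ s r → s := s :+ r :* con false) refl _ (pairing p₁ p₂))
        (nucleus {tangentLine} {affinePoint (p₁ , p₂)} isTangent)

      diagonal-N≉0 : diagonal n₁ n₂ ≉ 0#
      diagonal-N≉0 d≈0 = proj₂ N (isotropic⇒0 d≈0 pairing-N≈0)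

      base : Carrier → V
      base θ = φ ▹ (1# , θ)

      -- Net members are described in the chart, so the vector of P is replaced by the proportional
      -- `base θ`. The conditions on T and N are homogeneous and survive this.
      record Representative (P : Point₁) : Set (ℓ₀ ⊔ ℓ₁) where
        field
          θ      : Carrier
          θ≉0    : θ ≉ 0#
          norm≈δ : norm θ ≈ δ
          s      : Carrier
          s≉0    : s ≉ 0#
          x≈     : proj₁ (proj₁ P) ≈ s * proj₁ (base θ)
          y≈     : proj₂ (proj₁ P) ≈ s * proj₂ (base θ)

        x y : Carrier
        x = proj₁ (base θ)
        y = proj₂ (base θ)

        diagonal-rescale : diagonal (proj₁ (proj₁ P)) (proj₂ (proj₁ P)) ≈ (s * s) * diagonal x y
        diagonal-rescale = trans
          (+-cong (*-congˡ (*-cong x≈ x≈)) (*-congˡ (*-cong y≈ y≈)))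
          (solve 5 (λ a b s x y → a :* ((s :* x) :* (s :* x)) :+ b :* ((s :* y) :* (s :* y))
            := (s :* s) :* (a :* (x :* x) :+ b :* (y :* y))) refl a b s x y)

        pairing-rescale : pairing (proj₁ (proj₁ P)) (proj₂ (proj₁ P)) ≈ s * pairing x y
        pairing-rescale = trans
          (+-cong (*-congˡ x≈) (*-congˡ y≈))
          (solve 5 (λ g f s x y → g :* (s :* x) :+ f :* (s :* y)
              := s :* (g :* x :+ f :* y)) refl g f s x y)

      representative : ∀ {P} → P ∈ D → Representative P
      representative P∈D with proj₂ maps P∈D
      ... | Q , (θ , θ≉0 , norm≈δ , (r , r≉0 , (x≈ , y≈))) , (s , s≉0 , (x′≈ , y′≈)) = record
        { θ = θ ; θ≉0 = θ≉0 ; norm≈δ = norm≈δ ; s = s * r ; s≉0 = x*y≉0 s≉0 r≉0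
        ; x≈ = trans x′≈ (rescale _ _) ; y≈ = trans y′≈ (rescale _ _) }
        where
        rescale : ∀ e e′ → s * (e * proj₁ (proj₁ Q) + e′ * proj₂ (proj₁ Q)) ≈ (s * r) * (e * 1# + e′ * θ)
        rescale e e′ = trans (*-congˡ (+-cong (*-congˡ x≈) (*-congˡ y≈)))
          (solve 5 (λ s r e e′ θ → s :* (e :* (r :* con true) :+ e′ :* (r :* θ))
              := (s :* r) :* (e :* con true :+ e′ :* θ))
            refl s r e e′ θ)

      open Representative (representative T∈D) using ()
        renaming (θ to θ₁; θ≉0 to θ₁≉0; norm≈δ to norm-θ₁≈δ; x to u₁; y to u₂; s to s₁; s≉0 to s₁≉0;
                  diagonal-rescale to diagonal-T≈; pairing-rescale to pairing-T≈)
      open Representative (representative N∈D) using ()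
        renaming (θ to θ₂; θ≉0 to θ₂≉0; norm≈δ to norm-θ₂≈δ; x to w₁; y to w₂; s to s₂; s≉0 to s₂≉0;
                  diagonal-rescale to diagonal-N≈; pairing-rescale to pairing-N≈)

      diagonal-u≈0 : diagonal u₁ u₂ ≈ 0#
      diagonal-u≈0 = xy≈0⇒y≈0 (x*y≉0 s₁≉0 s₁≉0) (trans (sym diagonal-T≈) diagonal-T≈0)

      ε : Carrier
      ε = pairing u₁ u₂

      ε≉0 : ε ≉ 0#
      ε≉0 ε≈0 = pairing-T≉0 (trans pairing-T≈ (trans (*-congˡ ε≈0) (zeroʳ s₁)))

      α : Carrier
      α = diagonal w₁ w₂

      α≉0 : α ≉ 0#
      α≉0 α≈0 = diagonal-N≉0 (trans diagonal-N≈ (trans (*-congˡ α≈0) (zeroʳ (s₂ * s₂))))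

      pairing-w≈0 : pairing w₁ w₂ ≈ 0#
      pairing-w≈0 = xy≈0⇒y≈0 s₂≉0 (trans (sym pairing-N≈) pairing-N≈0)

      conjugate : ∃[ γ ] (γ ≉ 0# × γ ↑ (q ^ m) * θ₂ ≈ θ₁ * γ)
      conjugate = equalNorms⇒conjugate coprime θ₁≉0 θ₂≉0 (trans norm-θ₁≈δ (sym norm-θ₂≈δ))

      γ = proj₁ conjugate
      γ≉0 = proj₁ (proj₂ conjugate)

      -- In the notation of the introduction, A = α ε⁻¹ and C = c ε⁻¹.
      α⁻¹ ε⁻¹ η : Carrier
      α⁻¹ = proj₁ (inverse α≉0)
      ε⁻¹ = proj₁ (inverse ε≉0)
      η   = γ * (ε * α⁻¹)

      εε⁻¹≈1 : ε * ε⁻¹ ≈ 1#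
      εε⁻¹≈1 = proj₂ (inverse ε≉0)

      -- The relation A η = γ, cleared of denominators.
      αη≈γε : α * η ≈ γ * ε
      αη≈γε = begin
        α * (γ * (ε * α⁻¹))
          ≈⟨ solve 4 (λ α γ ε i → α :* (γ :* (ε :* i)) := (γ :* ε) :* (α :* i)) refl α γ ε α⁻¹ ⟩
        (γ * ε) * (α * α⁻¹) ≈⟨ *-congˡ (proj₂ (inverse α≉0)) ⟩
        (γ * ε) * 1#        ≈⟨ *-identityʳ _ ⟩
        γ * ε               ∎

      η≉0 : η ≉ 0#
      η≉0 η≈0 = x*y≉0 γ≉0 ε≉0 (trans (sym αη≈γε) (trans (*-congˡ η≈0) (zeroʳ α)))

      slope : ∃[ u ] (u ≉ 0# × norm u ≈ norm θ₂ × η ↑ (q ^ m) * u ≈ θ₂ * η)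
      slope = twist m θ₂≉0 η≉0

      u = proj₁ slope

      block : Block
      block = (u , proj₁ (proj₂ slope) , trans (proj₁ (proj₂ (proj₂ slope))) norm-θ₂≈δ) ,
              ((c * ε⁻¹) * u₁ , (c * ε⁻¹) * u₂)

      -- The coefficients A x² + C and x at x = η β, simplified by A η = γ. Every β gives a point of
      -- the conic; only the block restricts β to 𝔽_q.
      coeffT coeffN : Carrier → Carrier
      coeffT β = η * (γ * (β * β)) + c * ε⁻¹
      coeffN β = η * β

      point : Carrier → V
      point β = coeffT β * u₁ + coeffN β * w₁ , coeffT β * u₂ + coeffN β * w₂

      pairing-point : ∀ β → pairing (proj₁ (point β)) (proj₂ (point β)) ≈ coeffT β * ε
      pairing-point β = begin
        pairing (proj₁ (point β)) (proj₂ (point β))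
          ≈⟨ solve 8 (λ g f x y u₁ u₂ w₁ w₂ → g :* (y :* u₁ :+ x :* w₁) :+ f :* (y :* u₂ :+ x :* w₂)
               := y :* (g :* u₁ :+ f :* u₂) :+ x :* (g :* w₁ :+ f :* w₂))
               refl g f (coeffN β) (coeffT β) u₁ u₂ w₁ w₂ ⟩
        coeffT β * ε + coeffN β * pairing w₁ w₂
          ≈⟨ +-congˡ (trans (*-congˡ pairing-w≈0) (zeroʳ _)) ⟩
        coeffT β * ε + 0#
          ≈⟨ +-identityʳ _ ⟩
        coeffT β * ε ∎

      diagonal-point : ∀ β → diagonal (proj₁ (point β)) (proj₂ (point β)) ≈ (coeffN β * coeffN β) * α
      diagonal-point β = begin
        diagonal (proj₁ (point β)) (proj₂ (point β))
          ≈⟨ solve 8 (λ a b x y u₁ u₂ w₁ w₂ →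
               let X = y :* u₁ :+ x :* w₁
                   Y = y :* u₂ :+ x :* w₂ in
               a :* (X :* X) :+ b :* (Y :* Y)
               := (y :* y) :* (a :* (u₁ :* u₁) :+ b :* (u₂ :* u₂)) :+ (x :* x) :* (a :* (w₁ :* w₁) :+ b :* (w₂ :* w₂)))
               refl a b (coeffN β) (coeffT β) u₁ u₂ w₁ w₂ ⟩
        (coeffT β * coeffT β) * diagonal u₁ u₂ + (coeffN β * coeffN β) * α
          ≈⟨ +-congʳ (trans (*-congˡ diagonal-u≈0) (zeroʳ _)) ⟩
        0# + (coeffN β * coeffN β) * α
          ≈⟨ +-identityˡ _ ⟩
        (coeffN β * coeffN β) * α ∎

      point-on-conic : ∀ β → affinePoint (point β) ∈ points
      point-on-conic β = begin
        value (point β , 1#)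
          ≈⟨ value-affine _ _ 1# ⟩
        diagonal (proj₁ (point β)) (proj₂ (point β)) + c * (1# * 1#)
          + 1# * pairing (proj₁ (point β)) (proj₂ (point β))
          ≈⟨ +-cong (+-congʳ (diagonal-point β)) (*-congˡ (pairing-point β)) ⟩
        (coeffN β * coeffN β) * α + c * (1# * 1#) + 1# * (coeffT β * ε)
          ≈⟨ solve 7 (λ η γ β c i α ε →
               ((η :* β) :* (η :* β)) :* α :+ c :* (con true :* con true)
               :+ con true :* ((η :* (γ :* (β :* β)) :+ c :* i) :* ε)
               := (η :* (β :* β)) :* (α :* η :+ γ :* ε) :+ c :* (con true :+ ε :* i))
               refl η γ β c ε⁻¹ α ε ⟩
        (η * (β * β)) * (α * η + γ * ε) + c * (1# + ε * ε⁻¹)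
          ≈⟨ +-cong (*-congˡ (+-congʳ αη≈γε)) (*-congˡ (+-congˡ εε⁻¹≈1)) ⟩
        (η * (β * β)) * (γ * ε + γ * ε) + c * (1# + 1#)
          ≈⟨ solve 3 (λ e z c → e :* (z :+ z) :+ c :* (con true :+ con true)
              := con false) refl _ (γ * ε) c ⟩
        0# ∎

      -- The pairing kills the direction of N and so recovers `coeffT β`; two such values differ by
      -- η γ (β + β′)², and squaring is injective.
      point-injective : ∀ {β β′} → point β ≈ᵥ point β′ → β ≈ β′
      point-injective {β} {β′} (x≈ , y≈) = x+y≈0⇒x≈y (x²≈0⇒x≈0 (xy≈0⇒y≈0 (x*y≉0 (x*y≉0 η≉0 γ≉0) ε≉0) (begin
        ((η * γ) * ε) * ((β + β′) * (β + β′))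
          ≈⟨ solve 6 (λ η γ ε β β′ z → ((η :* γ) :* ε) :* ((β :+ β′) :* (β :+ β′))
               := (η :* (γ :* (β :* β)) :+ z) :* ε :+ (η :* (γ :* (β′ :* β′)) :+ z) :* ε)
               refl η γ ε β β′ (c * ε⁻¹) ⟩
        coeffT β * ε + coeffT β′ * ε
          ≈⟨ +-cong (pairing-point β) (pairing-point β′) ⟨
        pairing (proj₁ (point β)) (proj₂ (point β)) + pairing (proj₁ (point β′)) (proj₂ (point β′))
          ≈⟨ +-congʳ (+-cong (*-congˡ x≈) (*-congˡ y≈)) ⟩
        pairing (proj₁ (point β′)) (proj₂ (point β′)) + pairing (proj₁ (point β′)) (proj₂ (point β′))
          ≈⟨ x+x≈0 (pairing (proj₁ (point β′)) (proj₂ (point β′))) ⟩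
        0# ∎)))

      point-on-block : ∀ {β} → β ↑ q ≈ β → point β ∈Block[ m ] block
      point-on-block {β} β^q≈β =
        φ ▹ (s , s ↑ (q ^ m) * u) ,
        ((s , s ↑ (q ^ m) * u) , (s , (refl , refl)) , (refl , refl)) ,
        (component _ _ , component _ _)
        where
        -- Both T and N have first chart coordinate 1, so s is the sum of their coefficients without
        -- the constant c ε⁻¹, which is absorbed by the translation of the block.
        s = η * (γ * (β * β) + β)

        β^σ≈β : β ↑ (q ^ m) ≈ β
        β^σ≈β = fixed-q^ β^q≈β m

        s^σu≈ : s ↑ (q ^ m) * u ≈ η * (θ₁ * (γ * (β * β)) + θ₂ * β)
        s^σu≈ = begin
          s ↑ (q ^ m) * u
            ≈⟨ *-congʳ (trans (^-distrib-* η _ (q ^ m)) (*-congˡ (trans (frobenius-q^ m (γ * (β * β)) β)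
                 (+-cong (trans (^-distrib-* γ (β * β) (q ^ m))
                   (*-congˡ (trans (^-distrib-* β β (q ^ m)) (*-cong β^σ≈β β^σ≈β)))) β^σ≈β)))) ⟩
          (η ↑ (q ^ m) * (γ ↑ (q ^ m) * (β * β) + β)) * u
            ≈⟨ solve 4 (λ e z β u → (e :* (z :* (β :* β) :+ β)) :* u
                := (e :* u) :* (z :* (β :* β) :+ β))
                 refl (η ↑ (q ^ m)) (γ ↑ (q ^ m)) β u ⟩
          (η ↑ (q ^ m) * u) * (γ ↑ (q ^ m) * (β * β) + β)
            ≈⟨ *-congʳ (proj₂ (proj₂ (proj₂ slope))) ⟩
          (θ₂ * η) * (γ ↑ (q ^ m) * (β * β) + β)
            ≈⟨ solve 4 (λ θ₂ η z β → (θ₂ :* η) :* (z :* (β :* β) :+ β)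
                := η :* ((z :* θ₂) :* (β :* β) :+ θ₂ :* β))
                 refl θ₂ η (γ ↑ (q ^ m)) β ⟩
          η * ((γ ↑ (q ^ m) * θ₂) * (β * β) + θ₂ * β)
            ≈⟨ *-congˡ (+-congʳ (trans (*-congʳ (proj₂ (proj₂ conjugate))) (*-assoc θ₁ γ _))) ⟩
          η * (θ₁ * (γ * (β * β)) + θ₂ * β) ∎

        -- Here (e , e′) stands for a row of φ, so one identity covers both coordinates.
        component : ∀ e e′ →
          coeffT β * (e * 1# + e′ * θ₁) + coeffN β * (e * 1# + e′ * θ₂) ≈
          (c * ε⁻¹) * (e * 1# + e′ * θ₁) + (e * s + e′ * (s ↑ (q ^ m) * u))
        component e e′ = trans
          (solve 8 (λ η γ β z e e′ θ₁ θ₂ →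
            (η :* (γ :* (β :* β)) :+ z) :* (e :* con true :+ e′ :* θ₁) :+ (η :* β) :* (e :* con true :+ e′ :* θ₂)
            := z :* (e :* con true :+ e′ :* θ₁)
               :+ (e :* (η :* (γ :* (β :* β) :+ β)) :+ e′ :* (η :* (θ₁ :* (γ :* (β :* β)) :+ θ₂ :* β))))
            refl η γ β (c * ε⁻¹) e e′ θ₁ θ₂)
          (+-congˡ (+-congˡ (*-congˡ (sym s^σu≈))))

      notArc : ¬ IncidenceStructure.IsArc (andréPlane χ m) (transformedConic χ m 𝒞)
      -- Three parameters fixed by the q-th power suffice: 0, 1, and a further one supplied by a
      -- norm.
      notArc isArc = isArc {inj₁ (point 0#)} {inj₁ (point 1#)} {inj₁ (point β)}
        (point-on-conic 0#) (point-on-conic 1#) (point-on-conic β)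
        (distinct (λ 0≈1 → 1≉0 (sym 0≈1))) (distinct (λ 0≈β → β≉0 (sym 0≈β))) (distinct (λ 1≈β → β≉1 (sym 1≈β)))
        (just (inj₂ block) , on (0^q≈0) , on (1^n≈1 q) , on β^q≈β)
        where
        β = proj₁ ∃-fixed≉0,1
        β≉0 = proj₁ (proj₂ ∃-fixed≉0,1)
        β≉1 = proj₁ (proj₂ (proj₂ ∃-fixed≉0,1))
        β^q≈β = proj₂ (proj₂ (proj₂ ∃-fixed≉0,1))

        distinct : ∀ {β β′} → β ≉ β′ →
          ¬ IncidenceStructure._≈_ (andréPlane χ m) (inj₁ (point β)) (inj₁ (point β′))
        distinct β≉β′ eq = β≉β′ (point-injective (drop-inj₁ eq))

        on : ∀ {β} → β ↑ q ≈ β → IncidenceStructure._I_ (andréPlane χ m) (inj₁ (point β)) (just (inj₂ block))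
        on β^q≈β = affine (onBlock (point-on-block β^q≈β))

theorem7 : ∀ {c ℓ₁ ℓ₂ d} (q t : ℕ) →
    IsPrimePower q → 2 ∣ q → Prime t → 3 ≤ t → t ≤ q →
    (K : HeytingField c ℓ₁ ℓ₂) → HasOrder (HeytingField._≈_ K) (q ^ t) →
    let open Geometry K q t in
    (C : Conic) (D : Pred Point₁ d) → IsAndréSet D →
    (χ : ReplacementChart D) (T N : Point₁) →
    Conic.IsTangentAt C ℓ∞ (infinitePoint T) →
    Conic.IsNucleus C (infinitePoint N) →
    T ∈ D → N ∈ D →
    ∀ m → 1 ≤ m → m < t →
    ¬ IncidenceStructure.IsArc (andréPlane χ m) (transformedConic χ m C)
theorem7 q t primePower 2∣q t-prime 3≤t t≤q K order C D _ χ T N tangent nucleus T∈D N∈D m 1≤m m<t =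
  let k , q≡2^k = even-primePower primePower 2∣q in
  EvenPlane.TangentConic.Secant.notArc K q t (ℕ.≤-trans 3≤t t≤q) (ℕ.≤-trans (s≤s z≤n) 3≤t) k q≡2^k order
    C T tangent N (λ {ℓ} {P} → nucleus {ℓ} {P}) χ T∈D N∈D m
    (Coprime.sym (prime⇒coprime t-prime {{ℕ.>-nonZero 1≤m}} m<t))
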